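{- Let $S$ be either (i) a commutative semigroup whose universal semilattice is well-founded, or (ii) a solvable inverse semigroup whose semilattice of idempotents is well-founded. Then every nonprincipal strongly productive ultrafilter on $S$ is regular.
   Context: For a sequence $\vec{x}=(x_n)_{n\in\omega}$ in a semigroup $S$, $\mathrm{FP}(\vec{x})$ is the set of all products $\prod_{i\in a}x_i$ (in increasing order of indices), $a$ ranging over finite nonempty subsets of $\omega$, and $\mathrm{FP}_k(\vec{x})=\mathrm{FP}((x_{n+k})_{n\in\omega})$. An ultrafilter $p$ on $S$ is strongly productive if every $A\in p$ contains some $\mathrm{FP}(\vec{x})$ which belongs to $p$. A nonprincipal strongly productive ultrafilter $p$ is regular if there is $B\in p$ such that for every sequence $\vec{x}$ with $\mathrm{FP}(\vec{x})\subseteq B$, the set $x_0\mathrm{FP}_1(\vec{x})=\{x_0y: y\in\mathrm{FP}_1(\vec{x})\}$ does not belong to $p$. The universal semilattice of $S$ is the quotient by its smallest semilattice congruence; a semilattice is ordered by $x\le y$ iff $xy=x$, and is well-founded if every nonempty subset has a minimal element. Solvable inverse semigroups are in the sense of Piochi: class-$1$ solvable inverse semigroups are the commutative inverse semigroups, and one of class $n+1$ has a congruence $\gamma$ with $S/\gamma$ commutative such that $f^{ -1}[E(S/\gamma)]$ (with $f$ the quotient map, $E(\cdot)$ the set of idempotents) is a solvable inverse subsemigroup of class $n$. -}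

module Defs where

open import Algebra.Bundles using (Semigroup)
open import Algebra.Lattice.Bundles using (Semilattice)
import Algebra.Definitions as AlgDefs
open import Data.List.NonEmpty using (List⁺; toList; foldr₁; map)
open import Data.List.Relation.Unary.Linked using (Linked)
open import Data.Nat using (ℕ; _+_; _<_)
open import Data.Product using (Σ-syntax; ∃; ∃-syntax; ∃!; _×_; _,_; proj₁; proj₂)
open import Data.Sum using (_⊎_)
open import Function.Bundles using (_⇔_)
open import Level using (Level; suc)
open import Relation.Binary.Bundles using (Setoid)
open import Relation.Binary.Core using (Rel; _⇒_)
open import Relation.Binary.Structures using (IsEquivalence)
import Relation.Binary.Construct.NaturalOrder.Left as NaturalOrder
import Relation.Binary.Reasoning.Setoid as ≈-Reasoning
open import Relation.Nullary.Negation using (¬_)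
import Relation.Unary as Pred
open Pred using (Pred)

------------------------------------------------------------------------
-- Subsets and ultrafilters

-- The elements of a setoid are its ≈-classes, so its subsets are the
-- predicates that respect ≈.
record Subset {ℓ : Level} (X : Setoid ℓ ℓ) : Set (suc ℓ) where
  open Setoid X
  field
    pred : Pred Carrier ℓ
    resp : ∀ {x y} → x ≈ y → pred x → pred y

open Subset public

module _ {ℓ : Level} {X : Setoid ℓ ℓ} where
  open Setoid X

  infix 4 _∈_ _⊆_
  infixr 7 _∩_

  _∈_ : Carrier → Subset X → Set ℓ
  x ∈ A = pred A x

  _⊆_ : Subset X → Subset X → Set ℓ
  A ⊆ B = pred A Pred.⊆ pred B

  Empty : Subset X → Set ℓ
  Empty A = Pred.Empty (pred A)

  Nonempty : Subset X → Set ℓ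
  Nonempty A = Pred.Satisfiable (pred A)

  _∩_ : Subset X → Subset X → Subset X
  A ∩ B = record
    { pred = pred A Pred.∩ pred B
    ; resp = λ x≈y (x∈A , x∈B) → resp A x≈y x∈A , resp B x≈y x∈B
    }

  ∁ : Subset X → Subset X
  ∁ A = record
    { pred = Pred.∁ (pred A)
    ; resp = λ x≈y x∉A y∈A → x∉A (resp A (sym x≈y) y∈A)
    }

record Ultrafilter {ℓ : Level} (X : Setoid ℓ ℓ) : Set (suc ℓ) where
  field
    large   : Pred (Subset X) ℓ
    upward  : ∀ {A B} → A ⊆ B → large A → large B
    ∩-large : ∀ {A B} → large A → large B → large (A ∩ B)
    proper  : ∀ {A} → Empty A → ¬ large A
    ultra   : ∀ A → large A ⊎ large (∁ A)

open Ultrafilter public using (large)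

Nonprincipal : ∀ {ℓ} {X : Setoid ℓ ℓ} → Ultrafilter X → Set (suc ℓ)
Nonprincipal {X = X} p = ¬ (∃[ x ] ∀ (A : Subset X) → large p A ⇔ x ∈ A)

------------------------------------------------------------------------
-- Finite products, strongly productive and regular ultrafilters

module _ {ℓ : Level} (S : Semigroup ℓ ℓ) where
  open Semigroup S

  -- A finite nonempty subset of ω is given by its strictly increasing
  -- enumeration.
  FP : (ℕ → Carrier) → Subset setoid
  FP x = record
    { pred = λ y → Σ[ a ∈ List⁺ ℕ ] Linked _<_ (toList a) × y ≈ foldr₁ _∙_ (map x a)
    ; resp = λ y≈z (a , incr , y≈∏) → a , incr , trans (sym y≈z) y≈∏
    }

  FP[_] : ℕ → (ℕ → Carrier) → Subset setoid
  FP[ k ] x = FP (λ n → x (n + k))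

  translate : Carrier → Subset setoid → Subset setoid
  translate s A = record
    { pred = λ z → ∃[ y ] y ∈ A × z ≈ s ∙ y
    ; resp = λ z≈w (y , y∈A , z≈sy) → y , y∈A , trans (sym z≈w) z≈sy
    }

  StronglyProductive : Ultrafilter setoid → Set (suc ℓ)
  StronglyProductive p =
    ∀ A → large p A → ∃[ x ] FP x ⊆ A × large p (FP x)

  Regular : Ultrafilter setoid → Set (suc ℓ)
  Regular p = ∃[ B ] large p B ×
    (∀ (x : ℕ → Carrier) → FP x ⊆ B → ¬ large p (translate (x 0) (FP[ 1 ] x)))

------------------------------------------------------------------------
-- Well-founded semilattices

WellFoundedSemilattice : ∀ {ℓ} → Semilattice ℓ ℓ → Set (suc ℓ)
WellFoundedSemilattice L =
  ∀ (A : Subset setoid) → Nonempty A →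
  ∃[ m ] m ∈ A × (∀ y → y ∈ A → y ≤ m → y ≈ m)
  where
  open Semilattice L
  open NaturalOrder _≈_ _∙_ using (_≤_)

------------------------------------------------------------------------
-- Congruences and the universal semilattice

record Congruence {ℓ : Level} (S : Semigroup ℓ ℓ) : Set (suc ℓ) where
  open Semigroup S
  infix 4 _∼_
  field
    _∼_           : Rel Carrier ℓ
    isEquivalence : IsEquivalence _∼_
    ≈⇒∼           : _≈_ ⇒ _∼_
    ∙-cong        : ∀ {x y u v} → x ∼ y → u ∼ v → x ∙ u ∼ y ∙ v

_/_ : ∀ {ℓ} (S : Semigroup ℓ ℓ) → Congruence S → Semigroup ℓ ℓ
S / γ = record
  { Carrier     = Carrier
  ; _≈_         = _∼_
  ; _∙_         = _∙_
  ; isSemigroup = record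
    { isMagma = record { isEquivalence = isEquivalence ; ∙-cong = ∙-cong }
    ; assoc   = λ x y z → ≈⇒∼ (assoc x y z)
    }
  }
  where
  open Semigroup S using (Carrier; _∙_; assoc)
  open Congruence γ

IsCommutative : ∀ {ℓ} → Semigroup ℓ ℓ → Set ℓ
IsCommutative S = Commutative _∙_
  where
  open Semigroup S
  open AlgDefs _≈_

IsSemilatticeCongruence : ∀ {ℓ} {S : Semigroup ℓ ℓ} → Congruence S → Set ℓ
IsSemilatticeCongruence {S = S} γ = Idempotent _∙_ × Commutative _∙_
  where
  open Semigroup (S / γ)
  open AlgDefs _≈_

module _ {ℓ : Level} (S : Semigroup ℓ ℓ) where
  open Semigroup S

  infix 4 _η_

  -- The congruence generated by xx ∼ x and xy ∼ yx; η-least shows that it is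
  -- the smallest semilattice congruence.
  data _η_ : Rel Carrier ℓ where
    base   : ∀ {x y} → x ≈ y → x η y
    η-sym  : ∀ {x y} → x η y → y η x
    η-tran : ∀ {x y z} → x η y → y η z → x η z
    η-cong : ∀ {x y u v} → x η y → u η v → x ∙ u η y ∙ v
    η-idem : ∀ x → x ∙ x η x
    η-comm : ∀ x y → x ∙ y η y ∙ x

  ηCongruence : Congruence S
  ηCongruence = record
    { _∼_           = _η_
    ; isEquivalence = record { refl = base refl ; sym = η-sym ; trans = η-tran }
    ; ≈⇒∼           = base
    ; ∙-cong        = η-cong
    }

  η-isSemilatticeCongruence : IsSemilatticeCongruence ηCongruence
  η-isSemilatticeCongruence = η-idem , η-comm

  η-least : (γ : Congruence S) → IsSemilatticeCongruence γ → _η_ ⇒ Congruence._∼_ γ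
  η-least γ (idem , comm) = go
    where
    module γ = Congruence γ
    module γ≈ = IsEquivalence γ.isEquivalence
    go : _η_ ⇒ γ._∼_
    go (base x≈y)   = γ.≈⇒∼ x≈y
    go (η-sym r)    = γ≈.sym (go r)
    go (η-tran r s) = γ≈.trans (go r) (go s)
    go (η-cong r s) = γ.∙-cong (go r) (go s)
    go (η-idem x)   = idem x
    go (η-comm x y) = comm x y

  universalSemilattice : Semilattice ℓ ℓ
  universalSemilattice = record
    { isSemilattice = record
      { isBand = record
        { isSemigroup = Semigroup.isSemigroup (S / ηCongruence)
        ; idem        = η-idem
        }
      ; comm = η-comm
      }
    }

------------------------------------------------------------------------
-- Subsemigroups

module _ {ℓ : Level} (S : Semigroup ℓ ℓ) where
  open Semigroup S

  subsemigroup : (P : Pred Carrier ℓ) → (∀ {x y} → P x → P y → P (x ∙ y)) → Semigroup ℓ ℓ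
  subsemigroup P closed = record
    { Carrier     = ∃ P
    ; _≈_         = λ x y → proj₁ x ≈ proj₁ y
    ; _∙_         = λ (x , Px) (y , Py) → x ∙ y , closed Px Py
    ; isSemigroup = record
      { isMagma = record
        { isEquivalence = record { refl = refl ; sym = sym ; trans = trans }
        ; ∙-cong        = ∙-cong
        }
      ; assoc = λ (x , _) (y , _) (z , _) → assoc x y z
      }
    }

  IsIdempotent : Pred Carrier ℓ
  IsIdempotent x = _∙_ IdempotentOn x
    where open AlgDefs _≈_

  commutingIdempotents-closed : ∀ {x y} → x ∙ y ≈ y ∙ x →
    IsIdempotent x → IsIdempotent y → IsIdempotent (x ∙ y)
  commutingIdempotents-closed {x} {y} xy≈yx xx≈x yy≈y = begin
    (x ∙ y) ∙ (x ∙ y) ≈⟨ ∙-congˡ xy≈yx ⟩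
    (x ∙ y) ∙ (y ∙ x) ≈⟨ assoc x y (y ∙ x) ⟩
    x ∙ (y ∙ (y ∙ x)) ≈⟨ ∙-congˡ (sym (assoc y y x)) ⟩
    x ∙ ((y ∙ y) ∙ x) ≈⟨ ∙-congˡ (∙-congʳ yy≈y) ⟩
    x ∙ (y ∙ x)       ≈⟨ ∙-congˡ (sym xy≈yx) ⟩
    x ∙ (x ∙ y)       ≈⟨ sym (assoc x x y) ⟩
    (x ∙ x) ∙ y       ≈⟨ ∙-congʳ xx≈x ⟩
    x ∙ y             ∎
    where open ≈-Reasoning setoid

------------------------------------------------------------------------
-- Inverse semigroups

module _ {ℓ : Level} (S : Semigroup ℓ ℓ) where
  open Semigroup S

  _IsInverseOf_ : Rel Carrier ℓ
  y IsInverseOf x = (x ∙ y) ∙ x ≈ x × (y ∙ x) ∙ y ≈ y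

  IsInverseSemigroup : Set ℓ
  IsInverseSemigroup = ∀ x → ∃! _≈_ (_IsInverseOf x)

  module _ (inv : IsInverseSemigroup) where
    open ≈-Reasoning setoid

    private
      unique : ∀ {x y z} → y IsInverseOf x → z IsInverseOf x → y ≈ z
      unique {x} y-inv z-inv =
        let (_ , _ , uniq) = inv x in trans (sym (uniq y-inv)) (uniq z-inv)

      selfInverse : ∀ {x} → IsIdempotent S x → x IsInverseOf x
      selfInverse xx≈x = trans (∙-congʳ xx≈x) xx≈x , trans (∙-congʳ xx≈x) xx≈x

      absorbʳ : ∀ {e} x → IsIdempotent S e → (x ∙ e) ∙ e ≈ x ∙ e
      absorbʳ {e} x ee≈e = trans (assoc x e e) (∙-congˡ ee≈e)

      absorbˡ : ∀ {e} x → IsIdempotent S e → e ∙ (e ∙ x) ≈ e ∙ x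
      absorbˡ {e} x ee≈e = trans (sym (assoc e e x)) (∙-congʳ ee≈e)

      -- f x e is an inverse of e f whenever x is.
      sandwich : ∀ {e f x} → IsIdempotent S e → IsIdempotent S f →
        x IsInverseOf (e ∙ f) → ((f ∙ x) ∙ e) IsInverseOf (e ∙ f)
      sandwich {e} {f} {x} ee ff (efxef , xefx) = left , right
        where
        left : ((e ∙ f) ∙ ((f ∙ x) ∙ e)) ∙ (e ∙ f) ≈ e ∙ f
        left = begin
          ((e ∙ f) ∙ ((f ∙ x) ∙ e)) ∙ (e ∙ f) ≈⟨ ∙-congʳ (sym (assoc _ _ _)) ⟩
          (((e ∙ f) ∙ (f ∙ x)) ∙ e) ∙ (e ∙ f) ≈⟨ assoc _ _ _ ⟩
          ((e ∙ f) ∙ (f ∙ x)) ∙ (e ∙ (e ∙ f)) ≈⟨ ∙-cong (sym (assoc _ _ _)) (absorbˡ f ee) ⟩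
          (((e ∙ f) ∙ f) ∙ x) ∙ (e ∙ f)       ≈⟨ ∙-congʳ (∙-congʳ (absorbʳ e ff)) ⟩
          ((e ∙ f) ∙ x) ∙ (e ∙ f)             ≈⟨ efxef ⟩
          e ∙ f                               ∎
        right : (((f ∙ x) ∙ e) ∙ (e ∙ f)) ∙ ((f ∙ x) ∙ e) ≈ (f ∙ x) ∙ e
        right = begin
          (((f ∙ x) ∙ e) ∙ (e ∙ f)) ∙ ((f ∙ x) ∙ e) ≈⟨ ∙-congʳ (assoc _ _ _) ⟩
          ((f ∙ x) ∙ (e ∙ (e ∙ f))) ∙ ((f ∙ x) ∙ e) ≈⟨ ∙-congʳ (∙-congˡ (absorbˡ f ee)) ⟩
          ((f ∙ x) ∙ (e ∙ f)) ∙ ((f ∙ x) ∙ e)       ≈⟨ sym (assoc _ _ _) ⟩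
          (((f ∙ x) ∙ (e ∙ f)) ∙ (f ∙ x)) ∙ e       ≈⟨ ∙-congʳ (sym (assoc _ _ _)) ⟩
          ((((f ∙ x) ∙ (e ∙ f)) ∙ f) ∙ x) ∙ e       ≈⟨ ∙-congʳ (∙-congʳ (assoc _ _ _)) ⟩
          (((f ∙ x) ∙ ((e ∙ f) ∙ f)) ∙ x) ∙ e       ≈⟨ ∙-congʳ (∙-congʳ (∙-congˡ (absorbʳ e ff))) ⟩
          (((f ∙ x) ∙ (e ∙ f)) ∙ x) ∙ e             ≈⟨ ∙-congʳ (∙-congʳ (assoc _ _ _)) ⟩
          ((f ∙ (x ∙ (e ∙ f))) ∙ x) ∙ e             ≈⟨ ∙-congʳ (assoc _ _ _) ⟩
          (f ∙ ((x ∙ (e ∙ f)) ∙ x)) ∙ e             ≈⟨ ∙-congʳ (∙-congˡ xefx) ⟩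
          (f ∙ x) ∙ e                               ∎

      ef-idempotent : ∀ {e f} → IsIdempotent S e → IsIdempotent S f → IsIdempotent S (e ∙ f)
      ef-idempotent {e} {f} ee ff =
        let (x , x-inv , _) = inv (e ∙ f)
            x≈fxe = unique x-inv (sandwich ee ff x-inv)
            xx≈x : x ∙ x ≈ x
            xx≈x = begin
              x ∙ x                         ≈⟨ ∙-cong x≈fxe x≈fxe ⟩
              ((f ∙ x) ∙ e) ∙ ((f ∙ x) ∙ e) ≈⟨ sym (assoc _ _ _) ⟩
              (((f ∙ x) ∙ e) ∙ (f ∙ x)) ∙ e ≈⟨ ∙-congʳ (assoc _ _ _) ⟩
              ((f ∙ x) ∙ (e ∙ (f ∙ x))) ∙ e ≈⟨ ∙-congʳ (assoc _ _ _) ⟩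
              (f ∙ (x ∙ (e ∙ (f ∙ x)))) ∙ e ≈⟨ ∙-congʳ (∙-congˡ (∙-congˡ (sym (assoc _ _ _)))) ⟩
              (f ∙ (x ∙ ((e ∙ f) ∙ x))) ∙ e ≈⟨ ∙-congʳ (∙-congˡ (sym (assoc _ _ _))) ⟩
              (f ∙ ((x ∙ (e ∙ f)) ∙ x)) ∙ e ≈⟨ ∙-congʳ (∙-congˡ (proj₂ x-inv)) ⟩
              (f ∙ x) ∙ e                   ≈⟨ sym x≈fxe ⟩
              x                             ∎
            x≈ef = unique (selfInverse xx≈x) (proj₂ x-inv , proj₁ x-inv)
        in trans (∙-cong (sym x≈ef) (sym x≈ef)) (trans xx≈x x≈ef)

      fe-inverse : ∀ {e f} → IsIdempotent S e → IsIdempotent S f →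
        ((e ∙ f) ∙ (f ∙ e)) ∙ (e ∙ f) ≈ e ∙ f
      fe-inverse {e} {f} ee ff = begin
        ((e ∙ f) ∙ (f ∙ e)) ∙ (e ∙ f) ≈⟨ ∙-congʳ (sym (assoc _ _ _)) ⟩
        (((e ∙ f) ∙ f) ∙ e) ∙ (e ∙ f) ≈⟨ ∙-congʳ (∙-congʳ (absorbʳ e ff)) ⟩
        ((e ∙ f) ∙ e) ∙ (e ∙ f)       ≈⟨ assoc _ _ _ ⟩
        (e ∙ f) ∙ (e ∙ (e ∙ f))       ≈⟨ ∙-congˡ (absorbˡ f ee) ⟩
        (e ∙ f) ∙ (e ∙ f)             ≈⟨ ef-idempotent ee ff ⟩
        e ∙ f                         ∎

    idempotents-commute : ∀ {e f} → IsIdempotent S e → IsIdempotent S f → e ∙ f ≈ f ∙ e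
    idempotents-commute ee ff =
      unique (selfInverse (ef-idempotent ee ff)) (fe-inverse ee ff , fe-inverse ff ee)

    idempotentSemilattice : Semilattice ℓ ℓ
    idempotentSemilattice = record
      { isSemilattice = record
        { isBand = record
          { isSemigroup = Semigroup.isSemigroup
              (subsemigroup S (IsIdempotent S)
                (λ ee ff → commutingIdempotents-closed S (idempotents-commute ee ff) ee ff))
          ; idem = proj₂
          }
        ; comm = λ (_ , ee) (_ , ff) → idempotents-commute ee ff
        }
      }

------------------------------------------------------------------------
-- Solvable inverse semigroups

-- The preimage of E(S / γ) under the quotient map.
idempotentPreimage : ∀ {ℓ} (S : Semigroup ℓ ℓ) (γ : Congruence S) →
  IsCommutative (S / γ) → Semigroup ℓ ℓ
idempotentPreimage S γ comm =
  subsemigroup S (IsIdempotent (S / γ))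
    (λ {x} {y} → commutingIdempotents-closed (S / γ) (comm x y))

data IsSolvableInverse {ℓ : Level} : ℕ → Semigroup ℓ ℓ → Set (suc ℓ) where
  class-one : ∀ {S} → IsInverseSemigroup S → IsCommutative S → IsSolvableInverse 1 S
  class-suc : ∀ {n S} → IsInverseSemigroup S →
    (γ : Congruence S) (comm : IsCommutative (S / γ)) →
    IsSolvableInverse n (idempotentPreimage S γ comm) →
    IsSolvableInverse (ℕ.suc n) S

solvable⇒inverse : ∀ {ℓ n} {S : Semigroup ℓ ℓ} → IsSolvableInverse n S → IsInverseSemigroup S
solvable⇒inverse (class-one inv _)     = inv
solvable⇒inverse (class-suc inv _ _ _) = inv

module Submission where

-- Strong productivity makes the ambient logic classical, and regularity pulls
-- back along homomorphisms and extends from large subsemigroups.  A solvable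
-- inverse semigroup therefore reduces, through S / γ, to the commutative case.
-- There, let m be minimal in the universal semilattice with {x ≤ m} large.
-- Either the elements strictly below m witness regularity, or the archimedean
-- component of m is large.  In the latter case push forward to the group of
-- fractions of the component: if the image is principal, the ultrafilter lives
-- on a nil semigroup, where s S contains no large FP set missing the zero.
--
-- In an abelian group, failure of regularity at x gives a relation
-- x₀ + s + t = u with s, t, u ∈ FP₁(x).  If the elements of order at most 2
-- are large, the relation puts 0 into FP(x).  Otherwise, for each g = e n in a
-- large countable set with 2g ≠ 0, take a subgroup M maximal among those
-- avoiding 2g.  If all these M are large, a choice of sign at the first M
-- avoiding 2g refutes the relation; if one of them is not, then G / M is a
-- p-group with a unique subgroup of order p, and colouring by the leading
-- coefficient forces the orders of the xᵢ apart.

open import Defs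
open import Algebra.Bundles using (Semigroup; AbelianGroup; CommutativeSemigroup)
open import Algebra.Lattice.Bundles using (Semilattice)
open import Algebra.Morphism.Structures using (IsMagmaHomomorphism)
import Algebra.Properties.AbelianGroup as AbelianGroupProperties
import Algebra.Properties.CommutativeMonoid.Mult as Mult
import Algebra.Properties.CommutativeSemigroup as CommutativeSemigroupProperties
import Algebra.Solver.CommutativeMonoid as CommutativeMonoidSolver
open import Axiom.ExcludedMiddle using (ExcludedMiddle)
open import Data.Bool.Base using (Bool; true; false; if_then_else_)
open import Data.List.Base as List using (List; []; _∷_; _++_)
open import Data.List.NonEmpty as List⁺ using (List⁺; _∷_; foldr₁; toList)
open import Data.List.Relation.Unary.All as All using (All; []; _∷_)
import Data.List.Relation.Unary.All.Properties as All
open import Data.List.Relation.Unary.AllPairs using (AllPairs; []; _∷_)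
open import Data.List.Relation.Unary.Linked as Linked using (Linked; []; [-]; _∷_)
import Data.List.Relation.Unary.Linked.Properties as Linked
open import Data.Nat using (ℕ; zero; suc; _+_; _*_; _∸_; _^_; _<_; _≤_; z≤n; s≤s)
import Data.Nat.DivMod as ℕ
open import Data.Nat.Induction using (<-rec)
import Data.Nat.Properties as ℕ
open import Data.Product using (Σ-syntax; ∃; ∃-syntax; _×_; _,_; proj₁; proj₂)
open import Data.Sum as Sum using (_⊎_; inj₁; inj₂; [_,_]′)
open import Data.Unit.Polymorphic using (⊤)
open import Data.Vec.Base using (Vec; []; _∷_)
open import Function.Base using (_∘_; id)
open import Function.Bundles using (mk⇔)
open import Level using (Level) renaming (suc to lsuc)
open import Relation.Binary.Bundles using (Setoid)
open import Relation.Binary.Definitions using (tri<; tri≈; tri>)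
open import Relation.Binary.PropositionalEquality as ≡ using (_≡_; _≢_)
import Relation.Binary.Reasoning.Setoid as ≈-Reasoning
open import Relation.Binary.Structures using (IsEquivalence)
open import Relation.Nullary using (¬_; Dec; yes; no; contradiction)

-- Classical logic

module Classical {ℓ : Level} (em : ExcludedMiddle ℓ) where

  ¬¬-elim : {P : Set ℓ} → ¬ ¬ P → P
  ¬¬-elim {P} ¬¬p with em {P}
  ... | yes p = p
  ... | no ¬p = contradiction ¬p ¬¬p

  Least : (ℕ → Set ℓ) → ℕ → Set ℓ
  Least P n = P n × (∀ {m} → m < n → ¬ P m)

  least : (P : ℕ → Set ℓ) → ∃ P → ∃ (Least P)
  least P (n , p) = go n 0 (≡.subst P (≡.sym (ℕ.+-identityʳ n)) p) (λ ())
    where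
    -- `k + n` stays equal to the known witness, so the upward search ends there at the latest.
    go : ∀ k n → P (k + n) → (∀ {m} → m < n → ¬ P m) → ∃ (Least P)
    go zero    n p below = n , p , below
    go (suc k) n p below with em {P n}
    ... | yes q = n , q , below
    ... | no ¬q = go k (suc n) (≡.subst P (≡.sym (ℕ.+-suc k n)) p) λ m<1+n →
          [ below , (λ { ≡.refl → ¬q }) ]′ (ℕ.m<1+n⇒m<n∨m≡n m<1+n)

  least-unique : ∀ {P m n} → Least P m → Least P n → m ≡ n
  least-unique {m = m} {n} (Pm , <m) (Pn , <n) with ℕ.<-cmp m n
  ... | tri< m<n _ _ = contradiction Pm (<n m<n)
  ... | tri≈ _ m≡n _ = m≡n
  ... | tri> _ _ n<m = contradiction Pn (<m n<m)

-- Ultrafilters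

module _ {ℓ : Level} {X : Setoid ℓ ℓ} where
  open Setoid X

  singleton : Carrier → Subset X
  singleton x = record { pred = _≈ x ; resp = λ y≈z y≈x → trans (sym y≈z) y≈x }

  -- Unlike Nonprincipal, this does not quantify over subsets.
  Free : Ultrafilter X → Set ℓ
  Free p = ∀ x → ¬ large p (singleton x)

  module _ (p : Ultrafilter X) where
    open Ultrafilter p using (upward; ∩-large; proper; ultra)

    ∁-large : ∀ {A} → ¬ large p A → large p (∁ A)
    ∁-large {A} ¬A = [ (λ A-large → contradiction A-large ¬A) , id ]′ (ultra A)

    module _ (em : ExcludedMiddle ℓ) where
      open Classical em

      large⇒nonempty : ∀ {A} → large p A → Nonempty A
      large⇒nonempty lA = ¬¬-elim λ empty → proper (λ x x∈A → empty (x , x∈A)) lA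

      large-⊎ : ∀ {A} B C → large p A → (∀ {x} → x ∈ A → x ∈ B ⊎ x ∈ C) → large p B ⊎ large p C
      large-⊎ {A} B C lA cover with ultra B
      ... | inj₁ lB  = inj₁ lB
      ... | inj₂ l∁B = inj₂ (upward (λ (x∈A , x∉B) → [ (λ x∈B → contradiction x∈B x∉B) , id ]′ (cover x∈A))
                                    (∩-large lA l∁B))

      -- Induction on the number of pieces: if the last piece is not large, the rest of `A` is, and
      -- the earlier pieces cover it.
      large-⋃ : ∀ {A} (B : ℕ → Subset X) n → large p A →
        (∀ {x} → x ∈ A → ∃[ k ] k < n × x ∈ B k) → ∃[ k ] large p (B k)
      large-⋃ B zero    lA cover = let (x , x∈A) = large⇒nonempty lA in
        contradiction (proj₁ (proj₂ (cover x∈A))) λ ()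
      large-⋃ {A} B (suc n) lA cover with ultra (B n)
      ... | inj₁ lB  = n , lB
      ... | inj₂ l∁B = large-⋃ B n (∩-large lA l∁B) λ (x∈A , x∉Bn) →
        let (k , k<1+n , x∈Bk) = cover x∈A in
        k , ℕ.≤∧≢⇒< (ℕ.m<1+n⇒m≤n k<1+n) (λ k≡n → x∉Bn (≡.subst (λ k → _ ∈ B k) k≡n x∈Bk)) , x∈Bk

      principal-or-free : (∃[ x ] large p (singleton x)) ⊎ Free p
      principal-or-free with em {∃[ x ] large p (singleton x)}
      ... | yes principal = inj₁ principal
      ... | no  free      = inj₂ λ x l → free (x , l)

      nonprincipal⇒free : Nonprincipal p → Free p
      nonprincipal⇒free nonprincipal x lx = nonprincipal (x , λ A → mk⇔
        (λ lA → let (y , y∈A , y≈x) = large⇒nonempty (∩-large lA lx) in resp A y≈x y∈A)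
        (λ x∈A → upward (λ y≈x → resp A (sym y≈x) x∈A) lx))

-- Finite products

module _ {ℓ : Level} (S : Semigroup ℓ ℓ) where
  open Semigroup S

  product : (ℕ → Carrier) → List⁺ ℕ → Carrier
  product x a = foldr₁ _∙_ (List⁺.map x a)

  FP-single : ∀ x i → x i ∈ FP S x
  FP-single x i = i ∷ [] , [-] , refl

  FP-pair : ∀ x {i j} → i < j → (x i ∙ x j) ∈ FP S x
  FP-pair x i<j = _ ∷ _ ∷ [] , i<j ∷ [-] , refl

  map-suc-linked : ∀ {as} → Linked _<_ as → Linked _<_ (List.map (_+ 1) as)
  map-suc-linked = Linked.map⁺ ∘ Linked.map (ℕ.+-monoˡ-< 1)

  product-shift : ∀ x i as → product (λ n → x (n + 1)) (i ∷ as) ≡ product x (i + 1 ∷ List.map (_+ 1) as)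
  product-shift x i []       = ≡.refl
  product-shift x i (j ∷ as) = ≡.cong (x (i + 1) ∙_) (product-shift x j as)

  FP-tail : ∀ x → FP[_] S 1 x ⊆ FP S x
  FP-tail x (i ∷ as , incr , y≈) =
    i + 1 ∷ List.map (_+ 1) as , map-suc-linked incr , trans y≈ (reflexive (product-shift x i as))

  FP-cons : ∀ x → translate S (x 0) (FP[_] S 1 x) ⊆ FP S x
  FP-cons x (y , (i ∷ as , incr , y≈) , z≈) =
    0 ∷ i + 1 ∷ List.map (_+ 1) as ,
    ℕ.m≤n+m 1 i ∷ map-suc-linked incr ,
    trans z≈ (∙-congˡ (trans y≈ (reflexive (product-shift x i as))))

  -- FP sets are inhabited, so if the constant predicate P is large then P holds.
  sp⇒em : (p : Ultrafilter setoid) → StronglyProductive S p → ExcludedMiddle ℓ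
  sp⇒em p sp {P} with Ultrafilter.ultra p (record { pred = λ _ → P ; resp = λ _ → id })
  ... | inj₁ lP = let (x , FP⊆ , _) = sp _ lP in yes (FP⊆ (FP-single x 0))
  ... | inj₂ l¬P = let (x , FP⊆ , _) = sp _ l¬P in no (FP⊆ (FP-single x 0))

  -- An FP set inside the class of `x` has `y 0`, `y 1` and `y 0 ∙ y 1` all equal to `x`.
  sp-principal⇒idempotent : (p : Ultrafilter setoid) → StronglyProductive S p →
    ∀ {x} → large p (singleton x) → x ∙ x ≈ x
  sp-principal⇒idempotent p sp lx = let (y , FP⊆ , _) = sp _ lx in
    trans (sym (∙-cong (FP⊆ (FP-single y 0)) (FP⊆ (FP-single y 1))))
          (FP⊆ (FP-pair y (s≤s z≤n)))

-- Homomorphic images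

module _ {ℓ : Level} (S T : Semigroup ℓ ℓ) {f : Semigroup.Carrier S → Semigroup.Carrier T}
         (f-hom : IsMagmaHomomorphism (Semigroup.rawMagma S) (Semigroup.rawMagma T) f) where
  private
    module S = Semigroup S
    module T = Semigroup T
  open IsMagmaHomomorphism f-hom using (⟦⟧-cong; homo)

  preimage : Subset T.setoid → Subset S.setoid
  preimage A = record { pred = λ x → f x ∈ A ; resp = λ x≈y → resp A (⟦⟧-cong x≈y) }

  product-hom : ∀ x as → f (product S x as) T.≈ product T (f ∘ x) as
  product-hom x (i ∷ as) = go i as
    where
    go : ∀ i as → f (product S x (i ∷ as)) T.≈ product T (f ∘ x) (i ∷ as)
    go i []       = T.refl
    go i (j ∷ as) = T.trans (homo (x i) _) (T.∙-congˡ (go j as))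

  FP-image : ∀ x {y} → y ∈ FP S x → f y ∈ FP T (f ∘ x)
  FP-image x (as , incr , y≈) = as , incr , T.trans (⟦⟧-cong y≈) (product-hom x as)

  FP-coimage : ∀ x {z} → z ∈ FP T (f ∘ x) → ∃[ y ] y ∈ FP S x × f y T.≈ z
  FP-coimage x (as , incr , z≈) =
    product S x as , (as , incr , S.refl) , T.trans (product-hom x as) (T.sym z≈)

  FP-image-⊆ : ∀ x (A : Subset T.setoid) → FP S x ⊆ preimage A → FP T (f ∘ x) ⊆ A
  FP-image-⊆ x A FP⊆ z∈ = let (y , y∈ , fy≈z) = FP-coimage x z∈ in resp A fy≈z (FP⊆ y∈)

  translate-image : ∀ x {z} → z ∈ translate S (x 0) (FP[_] S 1 x) →
    f z ∈ translate T (f (x 0)) (FP[_] T 1 (f ∘ x))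
  translate-image x (y , y∈ , z≈) = f y , FP-image _ y∈ , T.trans (⟦⟧-cong z≈) (homo (x 0) y)

  module _ (p : Ultrafilter S.setoid) where
    open Ultrafilter p using (upward; ∩-large; proper; ultra)

    pushforward : Ultrafilter T.setoid
    pushforward = record
      { large   = large p ∘ preimage
      ; upward  = λ A⊆B → upward A⊆B
      ; ∩-large = λ lA lB → upward id (∩-large lA lB)
      ; proper  = λ empty → proper (empty ∘ f)
      ; ultra   = λ A → Sum.map₂ (upward id) (ultra (preimage A))
      }

    pushforward-sp : StronglyProductive S p → StronglyProductive T pushforward
    pushforward-sp sp A lA =
      let (x , FP⊆ , lFP) = sp (preimage A) lA in
      f ∘ x , FP-image-⊆ x A FP⊆ , upward (FP-image x) lFP

    pushforward-regular : Regular T pushforward → Regular S p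
    pushforward-regular (B , lB , bad) = preimage B , lB , λ x FP⊆ l →
      bad (f ∘ x) (FP-image-⊆ x B FP⊆) (upward (translate-image x) l)

-- Restriction to a large subsemigroup

module _ {ℓ : Level} (S : Semigroup ℓ ℓ) (P : Subset (Semigroup.setoid S))
         (closed : ∀ {x y} → x ∈ P → y ∈ P → Semigroup._∙_ S x y ∈ P) where
  private
    module S = Semigroup S
    T = subsemigroup S (pred P) closed
    module T = Semigroup T

  proj₁-hom : IsMagmaHomomorphism T.rawMagma S.rawMagma proj₁
  proj₁-hom = record
    { isRelHomomorphism = record { cong = id }
    ; homo              = λ _ _ → S.refl
    }

  image : Subset T.setoid → Subset S.setoid
  image A = record
    { pred = λ x → Σ[ x∈P ∈ x ∈ P ] (x , x∈P) ∈ A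
    ; resp = λ x≈y (x∈P , x∈A) → resp P x≈y x∈P , resp A x≈y x∈A
    }

  module _ (p : Ultrafilter S.setoid) (lP : large p P) where
    open Ultrafilter p using (upward; ∩-large; proper; ultra)

    restrict : Ultrafilter T.setoid
    restrict = record
      { large   = large p ∘ image
      ; upward  = λ A⊆B → upward (λ (x∈P , x∈A) → x∈P , A⊆B x∈A)
      ; ∩-large = λ {A} lA lB → upward
          -- Equality in `T` ignores membership proofs, so `resp A S.refl` may exchange one proof
          -- for another.
          (λ ((x∈P , x∈A) , (x∈P′ , x∈B)) → x∈P′ , resp A S.refl x∈A , x∈B)
          (∩-large lA lB)
      ; proper  = λ empty → proper (λ x (x∈P , x∈A) → empty (x , x∈P) x∈A)
      ; ultra   = λ A → Sum.map₂
          (λ l → upward (λ (x∈P , x∉A) → x∈P , λ x∈A → x∉A (x∈P , x∈A)) (∩-large lP l))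
          (ultra (image A))
      }

    restrict-free : Free p → Free restrict
    restrict-free free (x , _) l = free x (upward proj₂ l)

    restrict-sp : StronglyProductive S p → StronglyProductive T restrict
    restrict-sp sp A lA =
      let (x , FP⊆ , lFP) = sp (image A) lA
          x′ = λ n → x n , proj₁ (FP⊆ (FP-single S x n))
          lift : ∀ {y} (y∈ : y ∈ FP S x) → (y , proj₁ (FP⊆ y∈)) ∈ FP T x′
          lift = λ (as , incr , y≈) → as , incr , S.trans y≈ (S.sym (product-hom T S proj₁-hom x′ as))
      in x′ ,
         (λ {y} y∈ → resp A S.refl (proj₂ (FP⊆ (FP-image T S proj₁-hom x′ {y} y∈)))) ,
         upward (λ y∈ → proj₁ (FP⊆ y∈) , lift y∈) lFP

    restrict-regular : Regular T restrict → Regular S p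
    restrict-regular (B , lB , bad) = image B , lB , λ x FP⊆ l →
      let x′ = λ n → x n , proj₁ (FP⊆ (FP-single S x n))
          lift : ∀ {y} (y∈ : y ∈ FP T x′) → y ∈ B
          lift = λ {y} y∈ → resp B S.refl (proj₂ (FP⊆ (FP-image T S proj₁-hom x′ {y} y∈)))
      in bad x′ lift
           (upward (λ ((y , (as , incr , y≈) , z≈)) →
                      let y′ = product T (λ n → x′ (n + 1)) as
                          z≈′ = S.trans z≈ (S.∙-congˡ (S.trans y≈
                                  (S.sym (product-hom T S proj₁-hom (λ n → x′ (n + 1)) as))))
                      in resp P (S.sym z≈′) (proj₂ (x′ 0 T.∙ y′)) ,
                         y′ , (as , incr , S.refl) , z≈′)
                   l)

-- Finite sums in abelian groups

bounded : ∀ as → ∃[ n ] All (_< n) as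
bounded []       = 0 , []
bounded (i ∷ as) = let (n , as<n) = bounded as in
  suc (i + n) , s≤s (ℕ.m≤m+n i n) ∷ All.map (λ j<n → ℕ.<-≤-trans j<n (ℕ.m≤n⇒m≤1+n (ℕ.m≤n+m n i))) as<n

module _ {ℓ : Level} (G : AbelianGroup ℓ ℓ) where
  open AbelianGroup G
  open AbelianGroupProperties G
  open Mult commutativeMonoid using (×-congʳ; ×-homo-+; ×-assocˡ; ×-distrib-+) renaming (_×_ to infixr 7.5 _·_)
  open CommutativeMonoidSolver commutativeMonoid using (solve; _⊜_; _⊕_)
  open ≈-Reasoning setoid

  ·-ε : ∀ n → n · ε ≈ ε
  ·-ε zero    = refl
  ·-ε (suc n) = trans (identityˡ (n · ε)) (·-ε n)

  ·-inverse : ∀ n x → n · x ∙ n · (x ⁻¹) ≈ ε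
  ·-inverse n x = trans (sym (×-distrib-+ x (x ⁻¹) n)) (trans (×-congʳ n (inverseʳ x)) (·-ε n))

  -- Some FP set of a sequence `y` lies inside the translate, so `y 0`, `y 1` and `y 0 ∙ y 1` are
  -- `x 0` times `s`, `t` and `u`; cancelling one `x 0` leaves the relation.
  relation : (p : Ultrafilter setoid) → StronglyProductive semigroup p → ∀ x →
    large p (translate semigroup (x 0) (FP[_] semigroup 1 x)) →
    ∃[ s ] ∃[ t ] ∃[ u ] s ∈ FP[_] semigroup 1 x × t ∈ FP[_] semigroup 1 x × u ∈ FP[_] semigroup 1 x ×
      x 0 ∙ (s ∙ t) ≈ u
  relation p sp x l =
    let (y , FP⊆ , _) = sp _ l
        (s , s∈ , y₀≈) = FP⊆ (FP-single semigroup y 0)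
        (t , t∈ , y₁≈) = FP⊆ (FP-single semigroup y 1)
        (u , u∈ , y₀₁≈) = FP⊆ (FP-pair semigroup y (s≤s z≤n))
    in s , t , u , s∈ , t∈ , u∈ , ∙-cancelˡ (x 0) _ _ (begin
      x 0 ∙ (x 0 ∙ (s ∙ t))   ≈⟨ solve 3 (λ a s t → a ⊕ (a ⊕ (s ⊕ t)) ⊜ (a ⊕ s) ⊕ (a ⊕ t)) refl (x 0) s t ⟩
      (x 0 ∙ s) ∙ (x 0 ∙ t)   ≈⟨ ∙-cong (sym y₀≈) (sym y₁≈) ⟩
      y 0 ∙ y 1               ≈⟨ y₀₁≈ ⟩
      x 0 ∙ u                 ∎)

  sum : (ℕ → Carrier) → List ℕ → Carrier
  sum x []       = ε
  sum x (i ∷ as) = x i ∙ sum x as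

  product≈sum : ∀ x i as → product semigroup x (i ∷ as) ≈ sum x (i ∷ as)
  product≈sum x i []       = sym (identityʳ (x i))
  product≈sum x i (j ∷ as) = ∙-congˡ (product≈sum x j as)

  infixr 8 _⊙_
  _⊙_ : Bool → Carrier → Carrier
  b ⊙ g = if b then g else ε

  -- Bit vectors of one common length stand for the index sets of the three sums in `relation`,
  -- which can then be processed one index at a time.
  bitSum : (ℕ → Carrier) → ℕ → ∀ {n} → Vec Bool n → Carrier
  bitSum x k []       = ε
  bitSum x k (b ∷ bs) = b ⊙ x k ∙ bitSum x (suc k) bs

  sum⇒bitSum : ∀ x n k as → AllPairs _<_ as → All (k ≤_) as → All (_< k + n) as →
    ∃[ bs ] sum x as ≈ bitSum x k {n} bs
  sum⇒bitSum x zero k [] _ _ _ = [] , refl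
  sum⇒bitSum x zero k (i ∷ as) _ (k≤i ∷ _) (i<k+0 ∷ _) =
    contradiction (≡.subst (i <_) (ℕ.+-identityʳ k) i<k+0) (ℕ.≤⇒≯ k≤i)
  sum⇒bitSum x (suc n) k [] _ _ _ =
    let (bs , eq) = sum⇒bitSum x n (suc k) [] [] [] [] in
    false ∷ bs , trans eq (sym (identityˡ _))
  sum⇒bitSum x (suc n) k (i ∷ as) (i<as ∷ incr) (k≤i ∷ _) <k+n with k ℕ.≟ i
  ... | yes ≡.refl =
    let (bs , eq) = sum⇒bitSum x n (suc k) as incr i<as (≡.subst (λ m → All (_< m) as) (ℕ.+-suc k n) (All.tail <k+n))
    in true ∷ bs , ∙-congˡ eq
  ... | no k≢i =
    let k<i = ℕ.≤∧≢⇒< k≤i k≢i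
        (bs , eq) = sum⇒bitSum x n (suc k) (i ∷ as) (i<as ∷ incr)
          (k<i ∷ All.map (ℕ.<-trans k<i) i<as) (≡.subst (λ m → All (_< m) (i ∷ as)) (ℕ.+-suc k n) <k+n)
    in false ∷ bs , trans eq (sym (identityˡ _))

  FP⇒bitSum : ∀ x n as → Linked _<_ (toList as) → All (_< n) (toList as) →
    ∃[ bs ] product semigroup x as ≈ bitSum x 0 {n} bs
  FP⇒bitSum x n (i ∷ as) incr <n =
    let (bs , eq) = sum⇒bitSum x n 0 (i ∷ as) (Linked.Linked⇒AllPairs ℕ.<-trans incr) (All.universal (λ _ → z≤n) _) <n
    in bs , trans (product≈sum x i as) eq

  -- The level of g is an ultrametric valuation.  Two good elements of the same
  -- level n have K · a n · (g ∙ h) ≈ r ∙ r ≉ r, so their sum is not good.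
  -- Hence FP x ⊆ good makes the levels of the x i distinct, and x i, (x i)⁻¹
  -- and x i ∙ x i all have the same level.

  module Levels (r : Carrier) (2r≉ε : ¬ r ∙ r ≈ ε) (N K : ℕ) (a : ℕ → ℕ)
                (a-suc : ∀ n → a (suc n) ≡ N * a n) where

    AtLevel : ℕ → Carrier → Set ℓ
    AtLevel n g = a (suc n) · g ≈ ε × ¬ a n · g ≈ ε

    Good : ℕ → Carrier → Set ℓ
    Good n g = a (suc n) · g ≈ ε × K · (a n · g) ≈ r

    good : Subset setoid
    good = record
      { pred = λ g → ∃[ n ] Good n g
      ; resp = λ g≈h (n , kills , hits) →
          n , trans (×-congʳ (a (suc n)) (sym g≈h)) kills ,
          trans (×-congʳ K (×-congʳ (a n) (sym g≈h))) hits
      }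

    r≉ε : ¬ r ≈ ε
    r≉ε r≈ε = 2r≉ε (trans (∙-cong r≈ε r≈ε) (identityˡ ε))

    good⇒level : ∀ {n g} → Good n g → AtLevel n g
    good⇒level {n} (kills , hits) = kills , λ a·g≈ε →
      r≉ε (trans (sym hits) (trans (×-congʳ K a·g≈ε) (·-ε K)))

    kills-mono : ∀ {m n g} → m ≤ n → a m · g ≈ ε → a n · g ≈ ε
    kills-mono {m} {n} {g} m≤n a·g≈ε with ℕ.m≤n⇒m<n∨m≡n m≤n
    ... | inj₂ ≡.refl = a·g≈ε
    kills-mono {m} {suc n} {g} m≤n a·g≈ε | inj₁ (s≤s m≤n′) = begin
      a (suc n) · g   ≡⟨ ≡.cong (_· g) (a-suc n) ⟩
      (N * a n) · g   ≈⟨ ×-assocˡ g N (a n) ⟨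
      N · (a n · g)   ≈⟨ ×-congʳ N (kills-mono m≤n′ a·g≈ε) ⟩
      N · ε           ≈⟨ ·-ε N ⟩
      ε               ∎

    level-unique : ∀ {m n g} → AtLevel m g → AtLevel n g → m ≡ n
    level-unique {m} {n} (m-kills , m-not) (n-kills , n-not) with ℕ.<-cmp m n
    ... | tri< m<n _ _ = contradiction (kills-mono m<n m-kills) n-not
    ... | tri≈ _ m≡n _ = m≡n
    ... | tri> _ _ n<m = contradiction (kills-mono n<m n-kills) m-not

    level-resp : ∀ {n g h} → g ≈ h → AtLevel n g → AtLevel n h
    level-resp {n} g≈h (kills , not) =
      trans (×-congʳ (a (suc n)) (sym g≈h)) kills , not ∘ trans (×-congʳ (a n) g≈h)

    level-max : ∀ {m n g h} → m < n → AtLevel m g → AtLevel n h → AtLevel n (g ∙ h)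
    level-max {m} {n} {g} {h} m<n (g-kills , _) (h-kills , h-not) =
      (begin
        a (suc n) · (g ∙ h)            ≈⟨ ×-distrib-+ g h (a (suc n)) ⟩
        a (suc n) · g ∙ a (suc n) · h  ≈⟨ ∙-cong (kills-mono (ℕ.m≤n⇒m≤1+n m<n) g-kills) h-kills ⟩
        ε ∙ ε                          ≈⟨ identityˡ ε ⟩
        ε                              ∎) ,
      λ gh-kills → h-not (begin
        a n · h            ≈⟨ identityˡ _ ⟨
        ε ∙ a n · h        ≈⟨ ∙-congʳ (kills-mono m<n g-kills) ⟨
        a n · g ∙ a n · h  ≈⟨ ×-distrib-+ g h (a n) ⟨
        a n · (g ∙ h)      ≈⟨ gh-kills ⟩
        ε                  ∎)

    -- The nonzero values of (b + c - d) g for bits b, c, d.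
    Term : Carrier → Carrier → Set ℓ
    Term g t = t ≈ g ⊎ t ≈ g ⁻¹ ⊎ t ≈ g ∙ g

    good-double : ∀ n {g h} → Good n g → Good n h → AtLevel n (g ∙ h) × K · (a n · (g ∙ h)) ≈ r ∙ r
    good-double n {g} {h} (g-kills , g-hits) (h-kills , h-hits) = (kills , not) , hits
      where
      kills : a (suc n) · (g ∙ h) ≈ ε
      kills = trans (×-distrib-+ g h (a (suc n))) (trans (∙-cong g-kills h-kills) (identityˡ ε))
      hits : K · (a n · (g ∙ h)) ≈ r ∙ r
      hits = begin
        K · (a n · (g ∙ h))              ≈⟨ ×-congʳ K (×-distrib-+ g h (a n)) ⟩
        K · (a n · g ∙ a n · h)          ≈⟨ ×-distrib-+ (a n · g) (a n · h) K ⟩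
        K · (a n · g) ∙ K · (a n · h)    ≈⟨ ∙-cong g-hits h-hits ⟩
        r ∙ r                            ∎
      not : ¬ a n · (g ∙ h) ≈ ε
      not eq = 2r≉ε (trans (sym hits) (trans (×-congʳ K eq) (·-ε K)))

    good-distinct : ∀ {m n g h} → Good m g → Good n h → (g ∙ h) ∈ good → m ≢ n
    good-distinct {m} g-good h-good (k , gh-good) ≡.refl =
      let (level , hits) = good-double m g-good h-good in
      good-≡ (level-unique (good⇒level gh-good) level) gh-good hits
      where
      good-≡ : ∀ {k m g} → k ≡ m → Good k g → ¬ K · (a m · g) ≈ r ∙ r
      good-≡ ≡.refl (_ , hits) hits′ = r≉ε (∙-cancelˡ r r ε
        (trans (sym hits′) (trans hits (sym (identityʳ r)))))

    term-level : ∀ {n g t} → Good n g → Term g t → AtLevel n t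
    term-level g-good (inj₁ t≈g) = level-resp (sym t≈g) (good⇒level g-good)
    term-level {n} {g} g-good (inj₂ (inj₁ t≈g⁻¹)) =
      let (kills , not) = good⇒level g-good in
      level-resp (sym t≈g⁻¹)
        ( trans (sym (identityˡ _)) (trans (∙-congʳ (sym kills)) (·-inverse (a (suc n)) g))
        , λ eq → not (trans (sym (identityʳ _)) (trans (∙-congˡ (sym eq)) (·-inverse (a n) g))))
    term-level {n} g-good (inj₂ (inj₂ t≈gg)) = level-resp (sym t≈gg) (proj₁ (good-double n g-good g-good))

    coefficient : ∀ (b c d : Bool) g → let t = (b ⊙ g ∙ c ⊙ g) ∙ (d ⊙ g) ⁻¹ in t ≈ ε ⊎ Term g t
    coefficient b c true g with b | c
    ... | false | false = inj₂ (inj₂ (inj₁ (trans (∙-congʳ (identityˡ ε)) (identityˡ _))))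
    ... | true  | false = inj₁ (trans (∙-congʳ (identityʳ g)) (inverseʳ g))
    ... | false | true  = inj₁ (trans (∙-congʳ (identityˡ g)) (inverseʳ g))
    ... | true  | true  = inj₂ (inj₁ (trans (assoc g g _) (trans (∙-congˡ (inverseʳ g)) (identityʳ g))))
    coefficient b c false g = Sum.map (trans strip) (Sum.map (trans strip) (inj₂ ∘ trans strip)) (cases b c)
      where
      strip : ∀ {s} → s ∙ ε ⁻¹ ≈ s
      strip = trans (∙-congˡ ε⁻¹≈ε) (identityʳ _)
      cases : ∀ b c → let t = b ⊙ g ∙ c ⊙ g in t ≈ ε ⊎ t ≈ g ⊎ t ≈ g ∙ g
      cases false false = inj₁ (identityˡ ε)
      cases true  false = inj₂ (inj₁ (identityʳ g))
      cases false true  = inj₂ (inj₁ (identityˡ g))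
      cases true  true  = inj₂ (inj₂ refl)

    -- Brings the right-hand copy of `g` to the left, so that one index contributes (b + c - d) g to
    -- the partial sum `s`.
    collect : ∀ s g (b c d : Bool) {u v w} →
      s ∙ ((b ⊙ g ∙ u) ∙ (c ⊙ g ∙ v)) ≈ d ⊙ g ∙ w →
      (s ∙ ((b ⊙ g ∙ c ⊙ g) ∙ (d ⊙ g) ⁻¹)) ∙ (u ∙ v) ≈ w
    collect s g b c d {u} {v} {w} eq = begin
      (s ∙ ((b ⊙ g ∙ c ⊙ g) ∙ (d ⊙ g) ⁻¹)) ∙ (u ∙ v)
        ≈⟨ solve 6 (λ s b c d u v → (s ⊕ ((b ⊕ c) ⊕ d)) ⊕ (u ⊕ v) ⊜ d ⊕ (s ⊕ ((b ⊕ u) ⊕ (c ⊕ v))))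
                 refl s (b ⊙ g) (c ⊙ g) ((d ⊙ g) ⁻¹) u v ⟩
      (d ⊙ g) ⁻¹ ∙ (s ∙ ((b ⊙ g ∙ u) ∙ (c ⊙ g ∙ v)))
        ≈⟨ ∙-congˡ eq ⟩
      (d ⊙ g) ⁻¹ ∙ (d ⊙ g ∙ w)
        ≈⟨ \\-leftDividesʳ (d ⊙ g) w ⟩
      w ∎

    module _ (x : ℕ → Carrier) (FP⊆ : FP semigroup x ⊆ good) where

      -- s is a partial sum of the terms, and its level is that of x j for some
      -- index j already passed.
      no-relation : ∀ k {n} (u v w : Vec Bool n) s {m j} → j ≤ k → AtLevel m s → Good m (x j) →
        let x′ = λ n → x (n + 1) in ¬ s ∙ (bitSum x′ k u ∙ bitSum x′ k v) ≈ bitSum x′ k w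
      -- No index remains, so `s ≈ ε`, which has no level.
      no-relation k [] [] [] s _ (_ , not) _ eq = not (trans
        (×-congʳ (a _) (trans (sym (trans (∙-congˡ (identityˡ ε)) (identityʳ s))) eq)) (·-ε (a _)))
      no-relation k (b ∷ u) (c ∷ v) (d ∷ w) s {m} {j} j≤k s-level xj-good eq
        with coefficient b c d (x (k + 1)) | FP⊆ (FP-single semigroup x (k + 1))
      ... | inj₁ t≈ε | _ = no-relation (suc k) u v w _ (ℕ.m≤n⇒m≤1+n j≤k)
              (level-resp (sym (trans (∙-congˡ t≈ε) (identityʳ s))) s-level) xj-good
              (collect s (x (k + 1)) b c d eq)
      ... | inj₂ term | n , g-good with ℕ.<-cmp m n
      -- The new term dominates the partial sum, so `k + 1` becomes the index whose level is carried
      -- along.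
      ... | tri< m<n _ _ = no-relation (suc k) u v w _ (ℕ.≤-reflexive (ℕ.+-comm k 1))
              (level-max m<n s-level (term-level g-good term)) g-good
              (collect s (x (k + 1)) b c d eq)
      -- As `j < k + 1`, the product of `x j` and `x (k + 1)` is in `FP x`, hence good, and their
      -- levels must differ.
      ... | tri≈ _ m≡n _ = contradiction m≡n
              (good-distinct xj-good g-good
                (FP⊆ (FP-pair semigroup x (ℕ.≤-<-trans j≤k (ℕ.≤-reflexive (ℕ.+-comm 1 k))))))
      ... | tri> _ _ n<m = no-relation (suc k) u v w _ (ℕ.m≤n⇒m≤1+n j≤k)
              (level-resp (comm _ s) (level-max n<m (term-level g-good term) s-level)) xj-good
              (collect s (x (k + 1)) b c d eq)

    good-regular : (p : Ultrafilter setoid) → StronglyProductive semigroup p → large p good →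
      Regular semigroup p
    good-regular p sp lgood = good , lgood , λ x FP⊆ l →
      let (s , t , u , (as , as< , s≈) , (bs , bs< , t≈) , (cs , cs< , u≈) , eq) = relation p sp x l
          x′ = λ n → x (n + 1)
          -- One bound for all three index lists gives bit vectors of equal length.
          (n , all<n) = bounded (toList as ++ toList bs ++ toList cs)
          (as<n , bcs<n) = All.++⁻ (toList as) all<n
          (bs<n , cs<n) = All.++⁻ (toList bs) bcs<n
          (u₁ , e₁) = FP⇒bitSum x′ n as as< as<n
          (u₂ , e₂) = FP⇒bitSum x′ n bs bs< bs<n
          (u₃ , e₃) = FP⇒bitSum x′ n cs cs< cs<n
          (m , x₀-good) = FP⊆ (FP-single semigroup x 0)
      in no-relation x FP⊆ 0 u₁ u₂ u₃ (x 0) z≤n (good⇒level x₀-good) x₀-good (begin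
           x 0 ∙ (bitSum x′ 0 u₁ ∙ bitSum x′ 0 u₂) ≈⟨ ∙-congˡ (∙-cong (trans s≈ e₁) (trans t≈ e₂)) ⟨
           x 0 ∙ (s ∙ t)                           ≈⟨ eq ⟩
           u                                       ≈⟨ trans u≈ e₃ ⟩
           bitSum x′ 0 u₃                          ∎)

-- Abelian groups with an essential double

2^≡4^ : ∀ m → (∃[ i ] 2 ^ m ≡ 1 * 4 ^ i) ⊎ (∃[ i ] 2 ^ m ≡ 2 * 4 ^ i)
2^≡4^ zero    = inj₁ (0 , ≡.refl)
2^≡4^ (suc m) with 2^≡4^ m
... | inj₁ (i , eq) = inj₂ (i , ≡.trans (≡.cong (2 *_) eq) (≡.cong (2 *_) (ℕ.*-identityˡ (4 ^ i))))
... | inj₂ (i , eq) = inj₁ (suc i , ≡.trans (≡.cong (2 *_) eq)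
        (≡.trans (≡.sym (ℕ.*-assoc 2 2 (4 ^ i))) (≡.sym (ℕ.*-identityˡ (4 * 4 ^ i)))))

module _ {ℓ : Level} (em : ExcludedMiddle ℓ) (G : AbelianGroup ℓ ℓ) where
  open Classical em
  open AbelianGroup G
  open AbelianGroupProperties G
  open Mult commutativeMonoid using (×-congʳ; ×-congˡ; ×-homo-+; ×-homo-1; ×-assocˡ; ×-distrib-+) renaming (_×_ to infixr 7.5 _·_)
  open CommutativeMonoidSolver commutativeMonoid using (solve; _⊜_; _⊕_)
  open ≈-Reasoning setoid

  ·-comm : ∀ m n g → m · n · g ≈ n · m · g
  ·-comm m n g = begin
    m · n · g    ≈⟨ ×-assocˡ g m n ⟩
    (m * n) · g  ≡⟨ ≡.cong (_· g) (ℕ.*-comm m n) ⟩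
    (n * m) · g  ≈⟨ ×-assocˡ g n m ⟨
    n · m · g    ∎

  2·≈ : ∀ g → 2 · g ≈ g ∙ g
  2·≈ g = ∙-congˡ (identityʳ g)

  ·-split : ∀ {m n} g → m ≤ n → n · g ≈ m · g ∙ (n ∸ m) · g
  ·-split {m} {n} g m≤n = begin
    n · g                  ≡⟨ ≡.cong (_· g) (ℕ.m+[n∸m]≡n m≤n) ⟨
    (m + (n ∸ m)) · g      ≈⟨ ×-homo-+ g m (n ∸ m) ⟩
    m · g ∙ (n ∸ m) · g    ∎

  <-coincidence : ∀ {m n} g → m < n → m · g ≈ n · g → ∃[ d ] suc d · g ≈ ε
  <-coincidence {m} {n} g m<n eq with n ∸ m in n∸m≡ | ·-split g (ℕ.<⇒≤ m<n)
  ... | zero  | _     = contradiction (ℕ.m∸n≡0⇒m≤n n∸m≡) (ℕ.<⇒≱ m<n)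
  ... | suc d | split = d , ∙-cancelˡ (m · g) _ _ (trans (sym split) (trans (sym eq) (sym (identityʳ _))))

  coincidence⇒torsion : ∀ {m n} g → m ≢ n → m · g ≈ n · g → ∃[ d ] suc d · g ≈ ε
  coincidence⇒torsion {m} {n} g m≢n eq with ℕ.<-cmp m n
  ... | tri< m<n _ _ = <-coincidence g m<n eq
  ... | tri≈ _ m≡n _ = contradiction m≡n m≢n
  ... | tri> _ _ n<m = <-coincidence g n<m (sym eq)

  -- `essential` says that `c ∙ c` lies in the cyclic subgroup generated by any nonzero `g` of `H`;
  -- the integer multiple k - j is split into two natural ones.
  module Essential
    (H : Subset setoid)
    (∙-closed : ∀ {g h} → g ∈ H → h ∈ H → (g ∙ h) ∈ H) (ε∈H : ε ∈ H)
    (c : Carrier) (c∈H : c ∈ H) (t≉ε : ¬ c ∙ c ≈ ε)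
    (essential : ∀ {g} → g ∈ H → ¬ g ≈ ε → ∃[ j ] ∃[ k ] (c ∙ c) ∙ j · g ≈ k · g)
    where

    t : Carrier
    t = c ∙ c

    t∈H : t ∈ H
    t∈H = ∙-closed c∈H c∈H

    ·-closed : ∀ n {g} → g ∈ H → (n · g) ∈ H
    ·-closed zero    g∈H = ε∈H
    ·-closed (suc n) g∈H = ∙-closed g∈H (·-closed n g∈H)

    -- Essentiality applied to `t ∙ t` equates an odd with an even multiple of `t`.
    t-torsion : ∃[ d ] suc d · t ≈ ε
    t-torsion with em {t ∙ t ≈ ε}
    ... | yes tt≈ε = 1 , trans (2·≈ t) tt≈ε
    ... | no  tt≉ε =
      let (j , k , eq) = essential (∙-closed t∈H t∈H) tt≉ε
          double : ∀ n → n · (t ∙ t) ≈ (2 * n) · t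
          double n = trans (×-congʳ n (sym (2·≈ t))) (trans (×-assocˡ t n 2) (×-congˡ (ℕ.*-comm n 2)))
          eq′ : suc (2 * j) · t ≈ (2 * k) · t
          eq′ = trans (∙-congˡ (sym (double j))) (trans eq (double k))
      in coincidence⇒torsion t (ℕ.even≢odd k j ∘ ≡.sym) eq′

    module Order (q-1 : ℕ) (order : Least (λ d → suc d · t ≈ ε) q-1) where
      q : ℕ
      q = suc q-1

      reduce : ∀ k {g} → q · g ≈ ε → k · g ≈ (k ℕ.% q) · g
      reduce k {g} qg≈ε = begin
        k · g                                  ≡⟨ ≡.cong (_· g) (ℕ.m≡m%n+[m/n]*n k q) ⟩
        (k ℕ.% q + (k ℕ./ q) * q) · g          ≈⟨ ×-homo-+ g (k ℕ.% q) _ ⟩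
        (k ℕ.% q) · g ∙ ((k ℕ./ q) * q) · g    ≈⟨ ∙-congˡ (×-assocˡ g (k ℕ./ q) q) ⟨
        (k ℕ.% q) · g ∙ (k ℕ./ q) · (q · g)    ≈⟨ ∙-congˡ (trans (×-congʳ (k ℕ./ q) qg≈ε) (·-ε G (k ℕ./ q))) ⟩
        (k ℕ.% q) · g ∙ ε                      ≈⟨ identityʳ _ ⟩
        (k ℕ.% q) · g                          ∎

      kills-t⇒∣ : ∀ k → k · t ≈ ε → k ≡ (k ℕ./ q) * q
      kills-t⇒∣ k kt≈ε with k ℕ.% q in k%q≡ | ℕ.m≡m%n+[m/n]*n k q | ℕ.m%n<n k q | reduce k (proj₁ order)
      ... | zero  | eq | _          | _      = eq
      ... | suc r | _  | s≤s r<q-1 | kt≈rt = contradiction (trans (sym kt≈rt) kt≈ε) (proj₂ order r<q-1)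

      multiple : ∀ {g} → g ∈ H → ¬ g ≈ ε → ∃[ k ] k · g ≈ t
      multiple {g} g∈H g≉ε with essential g∈H g≉ε
      ... | j , k , eq with ℕ.≤-total j k
      ... | inj₁ j≤k = k ∸ j , ∙-cancelˡ (j · g) _ _ (trans (sym (·-split g j≤k)) (trans (sym eq) (comm t (j · g))))
      -- Here t = -d g, and `q-1` acts as -1 on multiples of `t`.
      ... | inj₂ k≤j = q-1 * d , (begin
        (q-1 * d) · g                    ≈⟨ ×-assocˡ g q-1 d ⟨
        q-1 · d · g                      ≈⟨ identityˡ _ ⟨
        ε ∙ q-1 · d · g                  ≈⟨ ∙-congʳ (proj₁ order) ⟨
        (t ∙ q-1 · t) ∙ q-1 · d · g      ≈⟨ assoc t _ _ ⟩
        t ∙ (q-1 · t ∙ q-1 · d · g)      ≈⟨ ∙-congˡ (×-distrib-+ t (d · g) q-1) ⟨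
        t ∙ q-1 · (t ∙ d · g)            ≈⟨ ∙-congˡ (×-congʳ q-1 tdg≈ε) ⟩
        t ∙ q-1 · ε                      ≈⟨ ∙-congˡ (·-ε G q-1) ⟩
        t ∙ ε                            ≈⟨ identityʳ t ⟩
        t                                ∎)
        where
        d = j ∸ k
        tdg≈ε : t ∙ d · g ≈ ε
        tdg≈ε = ∙-cancelˡ (k · g) _ _ (begin
          k · g ∙ (t ∙ d · g)    ≈⟨ solve 3 (λ a b c → a ⊕ (b ⊕ c) ⊜ b ⊕ (a ⊕ c)) refl (k · g) t (d · g) ⟩
          t ∙ (k · g ∙ d · g)    ≈⟨ ∙-congˡ (·-split g k≤j) ⟨
          t ∙ j · g              ≈⟨ eq ⟩
          k · g                  ≈⟨ identityʳ _ ⟨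
          k · g ∙ ε              ∎)

      1<q : 1 < q
      1<q = s≤s (ℕ.n≢0⇒n>0 λ q-1≡0 → t≉ε
        (trans (sym (×-homo-1 t)) (≡.subst (λ d → suc d · t ≈ ε) q-1≡0 (proj₁ order))))

      -- Strong induction on a `k` with `k · g ≈ t`. If `h = q · g` is nonzero, `k` kills `h` and
      -- therefore its multiple `t`; so `q` divides `k`, and the smaller `k / q` takes `h` to `t`.
      q-primary : ∀ {g} → g ∈ H → ∃[ n ] q ^ n · g ≈ ε
      q-primary {g} g∈H with em {g ≈ ε}
      ... | yes g≈ε = 0 , trans (×-homo-1 g) g≈ε
      ... | no g≉ε  = let (k , kg≈t) = multiple g∈H g≉ε in <-rec Claim step k g∈H kg≈t
        where
        Claim : ℕ → Set ℓ
        Claim k = ∀ {g} → g ∈ H → k · g ≈ t → ∃[ n ] q ^ n · g ≈ ε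
        step : ∀ k → (∀ {m} → m < k → Claim m) → Claim k
        step zero      _   _   ε≈t  = contradiction (sym ε≈t) t≉ε
        step k@(suc _) rec {g} g∈H kg≈t with em {q · g ≈ ε}
        ... | yes qg≈ε = 1 , trans (×-congˡ (ℕ.*-identityʳ q)) qg≈ε
        ... | no qg≉ε  =
          let h = q · g
              h∈H = ·-closed q g∈H
              (j , jh≈t) = multiple h∈H qg≉ε
              kh≈ε = trans (·-comm k q g) (trans (×-congʳ q kg≈t) (proj₁ order))
              kt≈ε = trans (×-congʳ k (sym jh≈t)) (trans (·-comm k j h) (trans (×-congʳ j kh≈ε) (·-ε G j)))
              k≡ = kills-t⇒∣ k kt≈ε
              (n , kills) = rec (ℕ.m/n<m k q 1<q) h∈H
                (trans (×-assocˡ g (k ℕ./ q) q) (trans (×-congˡ (≡.sym k≡)) kg≈t))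
          in suc n , trans (×-congˡ (ℕ.*-comm q (q ^ n))) (trans (sym (×-assocˡ g (q ^ n) q)) kills)

      -- `q ^ n · g` is a multiple of `t`, and `k` inverts its coefficient modulo `q`: these are the
      -- finitely many colours.
      Top : ℕ → Carrier → Set ℓ
      Top n g = q ^ suc n · g ≈ ε × ∃[ k ] k < q × k · q ^ n · g ≈ t

      top : ∀ {g} → g ∈ H → ¬ g ≈ ε → ∃[ n ] Top n g
      top {g} g∈H g≉ε with least (λ n → q ^ n · g ≈ ε) (q-primary g∈H)
      ... | zero  , g≈ε , _ = contradiction (trans (sym (×-homo-1 g)) g≈ε) g≉ε
      ... | suc n , kills , below =
        let (k , kz≈t) = multiple (·-closed (q ^ n) g∈H) (below (ℕ.n<1+n n)) in
        n , kills , k ℕ.% q , ℕ.m%n<n k q ,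
        trans (sym (reduce k (trans (×-assocˡ g q (q ^ n)) kills))) kz≈t

    module _ (p : Ultrafilter setoid) (sp : StronglyProductive semigroup p)
             (lH : large p H) (ε-small : ¬ large p (singleton ε)) where
      open Ultrafilter p using (∩-large)

      lH* : large p (H ∩ ∁ (singleton ε))
      lH* = ∩-large lH (∁-large p ε-small)

      -- Levels are counted in powers of `q` with `r = t`. The colours `k < q` cover the nonzero
      -- part of `H`, so one colour class is large.
      regular-tt≉ε : ¬ t ∙ t ≈ ε → Regular semigroup p
      regular-tt≉ε tt≉ε =
        let (q-1 , order) = least _ t-torsion
            open Order q-1 order
            module L k = Levels G t tt≉ε q k (q ^_) (λ _ → ≡.refl)
            (k , lgood) = large-⋃ p em L.good q lH* λ (g∈H , g≉ε) →
              let (n , kills , k , k<q , hits) = top g∈H g≉ε in k , k<q , n , kills , hits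
        in L.good-regular k p sp lgood

      -- `r = t` would violate `r ∙ r ≉ ε`, so `r = c` is used and levels go in steps of 4.
      -- Discarding `ε` and `t`, neither of them large, leaves elements of order at least 4.
      regular-tt≈ε : t ∙ t ≈ ε → Regular semigroup p
      regular-tt≈ε tt≈ε = let (k , lgood) = large-⋃ p em L.good 4 lH** cover in L.good-regular k p sp lgood
        where
        order : Least (λ d → suc d · t ≈ ε) 1
        order = trans (2·≈ t) tt≈ε , λ { (s≤s z≤n) → t≉ε ∘ trans (sym (×-homo-1 t)) }
        open Order 1 order

        -- Here 2^m g ≈ ±c for some m.  The parity of m fixes the factor in
        -- a n = factor · 4^n, and the sign fixes the multiplier (3 · c⁻¹ ≈ c).
        factor multiplier : ℕ → ℕ
        factor 0 = 1
        factor 1 = 1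
        factor _ = 2
        multiplier 0 = 1
        multiplier 1 = 3
        multiplier 2 = 1
        multiplier _ = 3

        module L k = Levels G c t≉ε 4 (multiplier k) (λ n → factor k * 4 ^ n)
          (λ n → ≡.trans (≡.sym (ℕ.*-assoc (factor k) 4 (4 ^ n)))
                   (≡.trans (≡.cong (_* 4 ^ n) (ℕ.*-comm (factor k) 4)) (ℕ.*-assoc 4 (factor k) (4 ^ n))))

        t-small : ¬ large p (singleton t)
        t-small lt = t≉ε (∙-cancelˡ t _ _ (trans (sp-principal⇒idempotent semigroup p sp lt) (sym (identityʳ t))))

        lH** : large p ((H ∩ ∁ (singleton ε)) ∩ ∁ (singleton t))
        lH** = ∩-large lH* (∁-large p t-small)

        hits⇒≈t : ∀ {k z} → k < 2 → k · z ≈ t → z ≈ t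
        hits⇒≈t {zero}        _ ε≈t = contradiction (sym ε≈t) t≉ε
        hits⇒≈t {suc zero}    _ eq  = trans (sym (×-homo-1 _)) eq
        hits⇒≈t {suc (suc _)} (s≤s (s≤s ()))

        -- `t` is a multiple of every nonzero `z`; when 2 kills `z`, the only possible multiple is
        -- `z` itself.
        zz≈ε⇒ : ∀ {z} → z ∈ H → z ∙ z ≈ ε → z ≈ ε ⊎ z ≈ t
        zz≈ε⇒ {z} z∈H zz≈ε with em {z ≈ ε}
        ... | yes z≈ε = inj₁ z≈ε
        ... | no  z≉ε = let (k , kz≈t) = multiple z∈H z≉ε in
          inj₂ (hits⇒≈t (ℕ.m%n<n k 2) (trans (sym (reduce k (trans (2·≈ z) zz≈ε))) kz≈t))

        -- 2 kills `z ∙ c`, so this element is `ε` or `t`; accordingly `z` is -c or c, and -3c = c.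
        zz≈t⇒ : ∀ {z} → z ∈ H → z ∙ z ≈ t → 1 · z ≈ c ⊎ 3 · z ≈ c
        zz≈t⇒ {z} z∈H zz≈t with zz≈ε⇒ (∙-closed z∈H c∈H)
          (trans (solve 2 (λ z c → (z ⊕ c) ⊕ (z ⊕ c) ⊜ (z ⊕ z) ⊕ (c ⊕ c)) refl z c) (trans (∙-congʳ zz≈t) tt≈ε))
        ... | inj₁ zc≈ε = inj₂ (∙-cancelʳ z _ _ (begin
          3 · z ∙ z          ≈⟨ ∙-congʳ (∙-congˡ (2·≈ z)) ⟩
          z ∙ (z ∙ z) ∙ z    ≈⟨ solve 1 (λ z → (z ⊕ (z ⊕ z)) ⊕ z ⊜ (z ⊕ z) ⊕ (z ⊕ z)) refl z ⟩
          (z ∙ z) ∙ (z ∙ z)  ≈⟨ ∙-cong zz≈t zz≈t ⟩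
          t ∙ t              ≈⟨ tt≈ε ⟩
          ε                  ≈⟨ zc≈ε ⟨
          z ∙ c              ≈⟨ comm z c ⟩
          c ∙ z              ∎))
        ... | inj₂ zc≈cc = inj₁ (trans (×-homo-1 z) (∙-cancelʳ c _ _ zc≈cc))

        cover : ∀ {g} → g ∈ ((H ∩ ∁ (singleton ε)) ∩ ∁ (singleton t)) → ∃[ k ] k < 4 × g ∈ L.good k
        cover {g} ((g∈H , g≉ε) , g≉t) with top g∈H g≉ε
        -- An element killed by 2 would be `t`, which was discarded.
        ... | zero , _ , _ , k<2 , hits = contradiction (trans (sym (×-homo-1 g)) (hits⇒≈t k<2 hits)) g≉t
        ... | suc m , kills , _ , k<2 , hits = split (2^≡4^ m) (zz≈t⇒ z∈H zz≈t)
          where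
          z = 2 ^ m · g
          z∈H = ·-closed (2 ^ m) g∈H
          zz≈t = trans (sym (2·≈ z)) (trans (×-assocˡ g 2 (2 ^ m)) (hits⇒≈t k<2 hits))
          kills′ : ∀ f i → 2 ^ m ≡ f * 4 ^ i → (f * 4 ^ suc i) · g ≈ ε
          kills′ f i eq = trans (×-congˡ lemma) kills
            where
            lemma : f * (4 * 4 ^ i) ≡ 2 * (2 * 2 ^ m)
            lemma = ≡.trans (≡.sym (ℕ.*-assoc f 4 _)) (≡.trans (≡.cong (_* 4 ^ i) (ℕ.*-comm f 4))
                      (≡.trans (ℕ.*-assoc 4 f _) (≡.trans (≡.cong (4 *_) (≡.sym eq)) (ℕ.*-assoc 2 2 (2 ^ m)))))
          split : (∃[ i ] 2 ^ m ≡ 1 * 4 ^ i) ⊎ (∃[ i ] 2 ^ m ≡ 2 * 4 ^ i) → 1 · z ≈ c ⊎ 3 · z ≈ c →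
            ∃[ k ] k < 4 × g ∈ L.good k
          split (inj₁ (i , eq)) (inj₁ hit) =
            0 , s≤s z≤n , i , kills′ 1 i eq , trans (×-congʳ 1 (×-congˡ (≡.sym eq))) hit
          split (inj₁ (i , eq)) (inj₂ hit) =
            1 , s≤s (s≤s z≤n) , i , kills′ 1 i eq , trans (×-congʳ 3 (×-congˡ (≡.sym eq))) hit
          split (inj₂ (i , eq)) (inj₁ hit) =
            2 , s≤s (s≤s (s≤s z≤n)) , i , kills′ 2 i eq , trans (×-congʳ 1 (×-congˡ (≡.sym eq))) hit
          split (inj₂ (i , eq)) (inj₂ hit) =
            3 , s≤s (s≤s (s≤s (s≤s z≤n))) , i , kills′ 2 i eq , trans (×-congʳ 3 (×-congˡ (≡.sym eq))) hit

      essential-regular : Regular semigroup p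
      essential-regular with em {t ∙ t ≈ ε}
      ... | yes tt≈ε = regular-tt≈ε tt≈ε
      ... | no  tt≉ε = regular-tt≉ε tt≉ε

-- Enumeration of lists

-- Walks along the antidiagonals: the first coordinate falls to 0, then the next diagonal starts.
unpair : ℕ → ℕ × ℕ
unpair zero = 0 , 0
unpair (suc n) with unpair n
... | zero  , b = suc b , 0
... | suc a , b = a , suc b

unpair-surjective : ∀ a b → ∃[ n ] unpair n ≡ (a , b)
unpair-surjective a b = go (a + b) a b ≡.refl
  where
  go : ∀ s a b → a + b ≡ s → ∃[ n ] unpair n ≡ (a , b)
  go s zero zero _ = 0 , ≡.refl
  go (suc s) (suc a) zero eq with go s 0 a (≡.trans (≡.sym (ℕ.+-identityʳ a)) (ℕ.suc-injective eq))
  ... | n , eq′ = suc n , lemma eq′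
    where
    lemma : unpair n ≡ (0 , a) → unpair (suc n) ≡ (suc a , 0)
    lemma eq′ rewrite eq′ = ≡.refl
  go s a (suc b) eq with go s (suc a) b (≡.trans (≡.sym (ℕ.+-suc a b)) eq)
  ... | n , eq′ = suc n , lemma eq′
    where
    lemma : unpair n ≡ (suc a , b) → unpair (suc n) ≡ (a , suc b)
    lemma eq′ rewrite eq′ = ≡.refl

decode : ℕ → ℕ → List ℕ
decode zero    m = []
decode (suc k) m = let (i , m′) = unpair m in i ∷ decode k m′

decode-surjective : ∀ as → ∃[ m ] decode (List.length as) m ≡ as
decode-surjective []       = 0 , ≡.refl
decode-surjective (i ∷ as) =
  let (m , eq) = decode-surjective as
      (n , eq′) = unpair-surjective i m
  in n , ≡.trans (≡.cong (λ (i , m) → i ∷ decode (List.length as) m) eq′) (≡.cong (i ∷_) eq)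

enumerate : ℕ → List ℕ
enumerate n = let (k , m) = unpair n in decode k m

enumerate-surjective : ∀ as → ∃[ n ] enumerate n ≡ as
enumerate-surjective as =
  let (m , eq) = decode-surjective as
      (n , eq′) = unpair-surjective (List.length as) m
  in n , ≡.trans (≡.cong (λ (k , m) → decode k m) eq′) eq

-- Finite intersections of large sets

module _ {ℓ : Level} {X : Setoid ℓ ℓ} (p : Ultrafilter X) where
  open Ultrafilter p using (upward; ∩-large; ultra)

  whole : Subset X
  whole = record { pred = λ _ → ⊤ ; resp = λ _ → id }

  whole-large : large p whole
  whole-large = [ id , upward _ ]′ (ultra whole)

  ⋂< : ℕ → (ℕ → Subset X) → Subset X
  ⋂< n A = record
    { pred = λ x → ∀ m → m < n → x ∈ A m
    ; resp = λ x≈y x∈A m m<n → resp (A m) x≈y (x∈A m m<n)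
    }

  ⋂<-large : ∀ A → (∀ n → large p (A n)) → ∀ n → large p (⋂< n A)
  ⋂<-large A lA zero    = upward (λ _ _ ()) whole-large
  ⋂<-large A lA (suc n) = upward
    (λ (x∈An , x∈⋂) m m<1+n → [ x∈⋂ m , (λ m≡n → ≡.subst (λ m → _ ∈ A m) (≡.sym m≡n) x∈An) ]′ (ℕ.m<1+n⇒m<n∨m≡n m<1+n))
    (∩-large (lA n) (⋂<-large A lA n))

module _ {ℓ : Level} (G : AbelianGroup ℓ ℓ) where
  open AbelianGroup G
  open AbelianGroupProperties G
  open Mult commutativeMonoid using (×-congʳ; ×-homo-+; ×-homo-1) renaming (_×_ to infixr 7.5 _·_)
  open CommutativeMonoidSolver commutativeMonoid using (solve; _⊜_; _⊕_)
  open ≈-Reasoning setoid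

  sum-++ : ∀ x as bs → sum G x (as ++ bs) ≈ sum G x as ∙ sum G x bs
  sum-++ x []       bs = sym (identityˡ _)
  sum-++ x (i ∷ as) bs = trans (∙-congˡ (sum-++ x as bs)) (sym (assoc _ _ _))

  -- Exponent two

  module _ (x : ℕ → Carrier) (xx≈ε : ∀ i → x i ∙ x i ≈ ε) where

    -- Adding `x i` is symmetric difference with {i}, since a repeated index cancels. Preservation
    -- of lower bounds is carried along to keep the list increasing.
    toggle : ∀ i as → AllPairs _<_ as → ∃[ bs ] AllPairs _<_ bs × x i ∙ sum G x as ≈ sum G x bs ×
      (∀ {k} → k < i → All (k <_) as → All (k <_) bs)
    toggle i [] [] = i ∷ [] , [] ∷ [] , refl , λ k<i _ → k<i ∷ []
    toggle i (j ∷ as) (j<as ∷ incr) with ℕ.<-cmp i j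
    ... | tri< i<j _ _ = i ∷ j ∷ as , (i<j ∷ All.map (ℕ.<-trans i<j) j<as) ∷ j<as ∷ incr , refl , _∷_
    ... | tri≈ _ ≡.refl _ = as , incr ,
            trans (sym (assoc _ _ _)) (trans (∙-congʳ (xx≈ε i)) (identityˡ _)) , λ _ → All.tail
    ... | tri> _ _ j<i =
      let (bs , incr′ , eq , lower) = toggle i as incr in
      j ∷ bs , lower j<i j<as ∷ incr′ ,
      trans (solve 3 (λ a b c → a ⊕ (b ⊕ c) ⊜ b ⊕ (a ⊕ c)) refl (x i) (x j) (sum G x as)) (∙-congˡ eq) ,
      λ { k<i (k<j ∷ k<as) → k<j ∷ lower k<i k<as }

    toggles : ∀ as → ∃[ bs ] AllPairs _<_ bs × sum G x as ≈ sum G x bs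
    toggles []       = [] , [] , refl
    toggles (i ∷ as) =
      let (bs , incr , eq) = toggles as
          (cs , incr′ , eq′ , _) = toggle i bs incr
      in cs , incr′ , trans (∙-congˡ eq) eq′

  involutions : Subset setoid
  involutions = record
    { pred = λ g → g ∙ g ≈ ε
    ; resp = λ g≈h gg≈ε → trans (sym (∙-cong g≈h g≈h)) gg≈ε
    }

  -- The relation turns into x₀ = s + t + u, and `toggles` rewrites the right side as a sum y over
  -- distinct later indices. Either y is empty and x₀ = 0, or x₀ + y = 0; both put 0 into `FP x`.
  exponent-two-regular : (p : Ultrafilter setoid) → StronglyProductive semigroup p →
    ¬ large p (singleton ε) → large p involutions → Regular semigroup p
  exponent-two-regular p sp ε-small linv =
    B , Ultrafilter.∩-large p linv (∁-large p ε-small) , bad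
    where
    B = involutions ∩ ∁ (singleton ε)
    bad : ∀ x → FP semigroup x ⊆ B → ¬ large p (translate semigroup (x 0) (FP[_] semigroup 1 x))
    bad x FP⊆ l with relation G p sp x l
    ... | s , t , u , s∈@(i ∷ as , _ , s≈) , t∈@(j ∷ bs , _ , t≈) , (k ∷ cs , _ , u≈) , eq =
      conclude (toggles x′ (λ n → proj₁ (FP⊆ (FP-single semigroup x (n + 1)))) ((i ∷ as) ++ (j ∷ bs) ++ (k ∷ cs)))
      where
      x′ : ℕ → Carrier
      x′ n = x (n + 1)
      inv : ∀ {s} → s ∈ FP[_] semigroup 1 x → s ∙ s ≈ ε
      inv s∈ = proj₁ (FP⊆ (FP-tail semigroup x s∈))
      x₀≈ : x 0 ≈ sum G x′ ((i ∷ as) ++ (j ∷ bs) ++ (k ∷ cs))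
      x₀≈ = begin
        x 0                               ≈⟨ identityʳ _ ⟨
        x 0 ∙ ε                           ≈⟨ ∙-congˡ (trans (∙-cong (inv s∈) (inv t∈)) (identityˡ ε)) ⟨
        x 0 ∙ ((s ∙ s) ∙ (t ∙ t))         ≈⟨ solve 3 (λ x s t → x ⊕ ((s ⊕ s) ⊕ (t ⊕ t)) ⊜ s ⊕ (t ⊕ (x ⊕ (s ⊕ t))))
                                               refl (x 0) s t ⟩
        s ∙ (t ∙ (x 0 ∙ (s ∙ t)))         ≈⟨ ∙-congˡ (∙-congˡ eq) ⟩
        s ∙ (t ∙ u)                       ≈⟨ ∙-cong (trans s≈ (product≈sum G x′ i as)) (∙-cong (trans t≈ (product≈sum G x′ j bs))
                                               (trans u≈ (product≈sum G x′ k cs))) ⟩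
        sum G x′ (i ∷ as) ∙ (sum G x′ (j ∷ bs) ∙ sum G x′ (k ∷ cs))
                                          ≈⟨ ∙-congˡ (sum-++ x′ (j ∷ bs) (k ∷ cs)) ⟨
        sum G x′ (i ∷ as) ∙ sum G x′ ((j ∷ bs) ++ (k ∷ cs))
                                          ≈⟨ sum-++ x′ (i ∷ as) _ ⟨
        sum G x′ ((i ∷ as) ++ (j ∷ bs) ++ (k ∷ cs)) ∎
      conclude : ¬ (∃[ ds ] AllPairs _<_ ds × sum G x′ ((i ∷ as) ++ (j ∷ bs) ++ (k ∷ cs)) ≈ sum G x′ ds)
      conclude ([] , _ , eq′) = proj₂ (FP⊆ (FP-single semigroup x 0)) (trans x₀≈ eq′)
      conclude (d ∷ ds , incr , eq′) =
        let y≈x₀ = trans (product≈sum G x′ d ds) (sym (trans x₀≈ eq′))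
            y∈ = d ∷ ds , Linked.AllPairs⇒Linked incr , refl
        in proj₂ (FP⊆ (FP-cons semigroup x (_ , y∈ , refl)))
             (trans (∙-congˡ y≈x₀) (proj₁ (FP⊆ (FP-single semigroup x 0))))

  -- Subgroups

  record Subgroup : Set (lsuc ℓ) where
    field
      subset    : Subset setoid
      ε∈        : ε ∈ subset
      ∙-closed  : ∀ {g h} → g ∈ subset → h ∈ subset → (g ∙ h) ∈ subset
      ⁻¹-closed : ∀ {g} → g ∈ subset → (g ⁻¹) ∈ subset

  open Subgroup

  trivial : Subgroup
  trivial = record
    { subset    = singleton ε
    ; ε∈        = refl
    ; ∙-closed  = λ g≈ε h≈ε → trans (∙-cong g≈ε h≈ε) (identityˡ ε)
    ; ⁻¹-closed = λ g≈ε → trans (⁻¹-cong g≈ε) ε⁻¹≈ε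
    }

  -- Integer multiples of `g` appear as differences of natural ones, `k` on the right and `j` on the
  -- left.
  adjoin : Subgroup → Carrier → Subgroup
  adjoin M g = record
    { subset    = record
      { pred = λ z → ∃[ m ] ∃[ j ] ∃[ k ] m ∈ subset M × z ∙ j · g ≈ m ∙ k · g
      ; resp = λ z≈w (m , j , k , m∈ , eq) → m , j , k , m∈ , trans (∙-congʳ (sym z≈w)) eq
      }
    ; ε∈        = ε , 0 , 0 , ε∈ M , refl
    ; ∙-closed  = λ {z} {w} (m , j , k , m∈ , eq) (m′ , j′ , k′ , m′∈ , eq′) →
        m ∙ m′ , j + j′ , k + k′ , ∙-closed M m∈ m′∈ , (begin
          (z ∙ w) ∙ (j + j′) · g          ≈⟨ ∙-congˡ (×-homo-+ g j j′) ⟩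
          (z ∙ w) ∙ (j · g ∙ j′ · g)      ≈⟨ interchange z w _ _ ⟩
          (z ∙ j · g) ∙ (w ∙ j′ · g)      ≈⟨ ∙-cong eq eq′ ⟩
          (m ∙ k · g) ∙ (m′ ∙ k′ · g)     ≈⟨ interchange m _ m′ _ ⟩
          (m ∙ m′) ∙ (k · g ∙ k′ · g)     ≈⟨ ∙-congˡ (×-homo-+ g k k′) ⟨
          (m ∙ m′) ∙ (k + k′) · g         ∎)
    ; ⁻¹-closed = λ {z} (m , j , k , m∈ , eq) → m ⁻¹ , k , j , ⁻¹-closed M m∈ , (begin
          z ⁻¹ ∙ k · g                    ≈⟨ ∙-congˡ (\\-leftDividesʳ m (k · g)) ⟨
          z ⁻¹ ∙ (m ⁻¹ ∙ (m ∙ k · g))     ≈⟨ ∙-congˡ (∙-congˡ eq) ⟨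
          z ⁻¹ ∙ (m ⁻¹ ∙ (z ∙ j · g))     ≈⟨ solve 4 (λ z′ m′ z j → z′ ⊕ (m′ ⊕ (z ⊕ j)) ⊜ m′ ⊕ (z′ ⊕ (z ⊕ j)))
                                                 refl (z ⁻¹) (m ⁻¹) z (j · g) ⟩
          m ⁻¹ ∙ (z ⁻¹ ∙ (z ∙ j · g))     ≈⟨ ∙-congˡ (\\-leftDividesʳ z (j · g)) ⟩
          m ⁻¹ ∙ j · g                    ∎)
    }
    where
    interchange : ∀ a b c d → (a ∙ b) ∙ (c ∙ d) ≈ (a ∙ c) ∙ (b ∙ d)
    interchange = solve 4 (λ a b c d → (a ⊕ b) ⊕ (c ⊕ d) ⊜ (a ⊕ c) ⊕ (b ⊕ d)) refl

  ⊆-adjoin : ∀ M g → subset M ⊆ subset (adjoin M g)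
  ⊆-adjoin M g m∈ = _ , 0 , 0 , m∈ , refl

  ∈-adjoin : ∀ M g → g ∈ subset (adjoin M g)
  ∈-adjoin M g = ε , 0 , 1 , ε∈ M , trans (identityʳ g) (sym (trans (identityˡ _) (×-homo-1 g)))


  quotient : Subgroup → AbelianGroup ℓ ℓ
  quotient M = record
    { Carrier = Carrier
    ; _≈_ = λ g h → ∃[ m ] m ∈ subset M × g ≈ m ∙ h
    ; _∙_ = _∙_
    ; ε   = ε
    ; _⁻¹ = _⁻¹
    ; isAbelianGroup = record
      { isGroup = record
        { isMonoid = record
          { isSemigroup = record
            { isMagma = record
              { isEquivalence = record
                { refl  = lift refl
                ; sym   = λ (m , m∈ , eq) → m ⁻¹ , ⁻¹-closed M m∈ ,
                    sym (trans (∙-congˡ eq) (\\-leftDividesʳ m _))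
                ; trans = λ (m , m∈ , eq) (n , n∈ , eq′) → m ∙ n , ∙-closed M m∈ n∈ ,
                    trans eq (trans (∙-congˡ eq′) (sym (assoc m n _)))
                }
              ; ∙-cong = λ (m , m∈ , eq) (n , n∈ , eq′) → m ∙ n , ∙-closed M m∈ n∈ ,
                  trans (∙-cong eq eq′)
                    (solve 4 (λ a b c d → (a ⊕ b) ⊕ (c ⊕ d) ⊜ (a ⊕ c) ⊕ (b ⊕ d)) refl m _ n _)
              }
            ; assoc = λ x y z → lift (assoc x y z)
            }
          ; identity = lift ∘ identityˡ , lift ∘ identityʳ
          }
        ; inverse = lift ∘ inverseˡ , lift ∘ inverseʳ
        ; ⁻¹-cong = λ (m , m∈ , eq) → m ⁻¹ , ⁻¹-closed M m∈ , trans (⁻¹-cong eq) (sym (⁻¹-∙-comm m _))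
        }
      ; comm = λ x y → lift (comm x y)
      }
    }
    where
    lift : ∀ {g h} → g ≈ h → ∃[ m ] m ∈ subset M × g ≈ m ∙ h
    lift g≈h = ε , ε∈ M , trans g≈h (sym (identityˡ _))

-- Countable submonoids and maximal subgroups avoiding an element

module _ {ℓ : Level} (em : ExcludedMiddle ℓ) (G : AbelianGroup ℓ ℓ) where
  open Classical em
  open AbelianGroup G
  open AbelianGroupProperties G
  open Mult commutativeMonoid using (×-congʳ; ×-homo-+; ×-homo-1) renaming (_×_ to infixr 7.5 _·_)
  open CommutativeMonoidSolver commutativeMonoid using (solve; _⊜_; _⊕_)
  open ≈-Reasoning setoid
  open Subgroup

  module Enumerated (e : ℕ → Carrier) where

    H : Subset setoid
    H = record { pred = λ g → ∃[ n ] e n ≈ g ; resp = λ g≈h (n , eq) → n , trans eq g≈h }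

    module _ (r : Carrier) where

      -- Adjoin e 0, e 1, … in turn, skipping those that would capture r.
      stage : ℕ → Subgroup G
      extend : ∀ n → Dec (r ∈ subset (adjoin G (stage n) (e n))) → Subgroup G
      stage zero    = trivial G
      stage (suc n) = extend n em
      extend n (yes _) = stage n
      extend n (no  _) = adjoin G (stage n) (e n)

      stage-suc : ∀ n → subset (stage n) ⊆ subset (stage (suc n))
      stage-suc n with em {r ∈ subset (adjoin G (stage n) (e n))}
      ... | yes _ = id
      ... | no  _ = ⊆-adjoin G (stage n) (e n)

      stage-mono : ∀ m n → subset (stage n) ⊆ subset (stage (m + n))
      stage-mono zero    n g∈ = g∈
      stage-mono (suc m) n g∈ = stage-suc (m + n) (stage-mono m n g∈)

      avoiding : Subgroup G
      avoiding = record
        { subset    = record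
          { pred = λ g → ∃[ n ] g ∈ subset (stage n)
          ; resp = λ g≈h (n , g∈) → n , resp (subset (stage n)) g≈h g∈
          }
        ; ε∈        = 0 , refl
        ; ∙-closed  = λ {g} {h} (m , g∈) (n , h∈) → m + n ,
            ∙-closed (stage (m + n)) (≡.subst (λ k → g ∈ subset (stage k)) (ℕ.+-comm n m) (stage-mono n m g∈))
                                     (stage-mono m n h∈)
        ; ⁻¹-closed = λ (n , g∈) → n , ⁻¹-closed (stage n) g∈
        }

      ∉avoiding : ¬ r ≈ ε → ¬ r ∈ subset avoiding
      ∉avoiding r≉ε (n , r∈) = ∉stage n r∈
        where
        ∉stage : ∀ n → ¬ r ∈ subset (stage n)
        ∉stage zero    = r≉ε
        ∉stage (suc n) with em {r ∈ subset (adjoin G (stage n) (e n))}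
        ... | yes _ = ∉stage n
        ... | no r∉ = r∉

      stage-maximal : ∀ n → r ∈ subset (adjoin G (stage n) (e n)) ⊎ e n ∈ subset (stage (suc n))
      stage-maximal n with em {r ∈ subset (adjoin G (stage n) (e n))}
      ... | yes r∈ = inj₁ r∈
      ... | no  _  = inj₂ (∈-adjoin G (stage n) (e n))

      -- `e n` was skipped only because adjoining it to `stage n` captures `r`, and `stage n` lies
      -- inside `avoiding`.
      avoiding-maximal : ∀ n → ¬ e n ∈ subset avoiding → r ∈ subset (adjoin G avoiding (e n))
      avoiding-maximal n e∉ with stage-maximal n
      ... | inj₁ (m , j , k , m∈ , eq) = m , j , k , (n , m∈) , eq
      ... | inj₂ e∈                    = contradiction (suc n , e∈) e∉

    avoid : ℕ → Subgroup G
    avoid n = avoiding (e n ∙ e n)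

    module _ (p : Ultrafilter setoid) (sp : StronglyProductive semigroup p) (lH : large p H)
             (H-∙-closed : ∀ {g h} → g ∈ H → h ∈ H → (g ∙ h) ∈ H) (ε∈H : ε ∈ H) where

      -- Modulo `M` the double of `e n` is nonzero, and maximality of `M` makes it essential for the
      -- image of `H`. Smallness of `M` keeps the image of `p` from concentrating at the identity.
      quotient-regular : ∀ n → ¬ e n ∙ e n ≈ ε → ¬ large p (subset (avoid n)) → Regular semigroup p
      quotient-regular n t≉ε M-small =
        pushforward-regular semigroup Q.semigroup hom p
          (Essential.essential-regular em Q H/M closed (lift∈ ε∈H) (e n) (n , Q.refl) t≉Qε essential
             (pushforward semigroup Q.semigroup hom p) (pushforward-sp semigroup Q.semigroup hom p sp)
             (upward lift∈ lH) ε-small)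
        where
        open Ultrafilter p using (upward)
        M = avoid n
        Q = quotient G M
        module Q = AbelianGroup Q
        module Q× = Mult Q.commutativeMonoid
        hom : IsMagmaHomomorphism (Semigroup.rawMagma semigroup) (Semigroup.rawMagma Q.semigroup) id
        hom = record
          { isRelHomomorphism = record { cong = ≈⇒≈Q }
          ; homo              = λ _ _ → Q.refl
          }
          where
          ≈⇒≈Q : ∀ {g h} → g ≈ h → g Q.≈ h
          ≈⇒≈Q g≈h = ε , ε∈ M , trans g≈h (sym (identityˡ _))
        open IsMagmaHomomorphism hom using (⟦⟧-cong)
        H/M : Subset Q.setoid
        H/M = record { pred = λ g → ∃[ n ] e n Q.≈ g ; resp = λ g≈h (n , eq) → n , Q.trans eq g≈h }
        lift∈ : ∀ {g} → g ∈ H → g ∈ H/M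
        lift∈ (n , eq) = n , ⟦⟧-cong eq
        closed : ∀ {g h} → g ∈ H/M → h ∈ H/M → (g ∙ h) ∈ H/M
        closed (m , eq) (n , eq′) =
          let (k , eq″) = H-∙-closed (m , refl) (n , refl) in k , Q.trans (⟦⟧-cong eq″) (Q.∙-cong eq eq′)
        ≈Qε⇒∈ : ∀ {g} → g Q.≈ ε → g ∈ subset M
        ≈Qε⇒∈ (m , m∈ , eq) = resp (subset M) (sym (trans eq (identityʳ m))) m∈
        t≉Qε : ¬ (e n ∙ e n) Q.≈ ε
        t≉Qε = ∉avoiding (e n ∙ e n) t≉ε ∘ ≈Qε⇒∈
        ε-small : ¬ large p (record { pred = Q._≈ ε ; resp = λ g≈h g≈ε → Q.trans (Q.sym (⟦⟧-cong g≈h)) g≈ε })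
        ε-small = M-small ∘ upward ≈Qε⇒∈
        ·≡ : ∀ k g → k · g ≡ k Q×.× g
        ·≡ zero    g = ≡.refl
        ·≡ (suc k) g = ≡.cong (g ∙_) (·≡ k g)
        essential : ∀ {g} → g ∈ H/M → ¬ g Q.≈ ε → ∃[ j ] ∃[ k ] ((e n ∙ e n) ∙ (j Q×.× g)) Q.≈ (k Q×.× g)
        essential {g} (i , ei≈g) g≉ε =
          let (m , j , k , m∈ , eq) = avoiding-maximal (e n ∙ e n) i λ ei∈ →
                g≉ε (Q.trans (Q.sym ei≈g) (e i , ei∈ , sym (identityʳ (e i))))
              change : ∀ k → (k · e i) Q.≈ (k Q×.× g)
              change k = Q.trans (Q.reflexive (·≡ k (e i))) (Q×.×-congʳ k ei≈g)
          in j , k , Q.trans (Q.∙-congˡ (Q.sym (change j))) (Q.trans (m , m∈ , eq) (change k))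

      -- x is signed at the first n for which avoid n misses x ∙ x.  If x₀ ∙ y
      -- lies in avoid m for all m ≤ n then y is signed at the same n as x₀,
      -- with the opposite sign.

      Separates : ℕ → Carrier → Set ℓ
      Separates n g = ¬ e n ∙ e n ≈ ε × ¬ (g ∙ g) ∈ subset (avoid n)

      module Signed (Sign : ℕ → Carrier → Set ℓ)
                    (not-opposite : ∀ {n g h} → Sign n g → Sign n h → ¬ (g ∙ h) ∈ subset (avoid n)) where

        HasSign : Carrier → Set ℓ
        HasSign g = ∃[ n ] Least (λ n → Separates n g) n × Sign n g

        -- Closing under `≈` makes this a `Subset` for an arbitrary `Sign`.
        signed : Subset setoid
        signed = record
          { pred = λ g → ∃[ h ] h ≈ g × HasSign h
          ; resp = λ g≈g′ (h , h≈g , sign) → h , trans h≈g g≈g′ , sign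
          }

        -- Modulo `avoid n`, g = -h and hence 2g = -2h.
        separates-transfer : ∀ {n g h} → (g ∙ h) ∈ subset (avoid n) → Separates n g → Separates n h
        separates-transfer {n} {g} {h} gh∈ (t≉ε , gg∉) = t≉ε , λ hh∈ → gg∉
          (resp (subset (avoid n)) (begin
              ((g ∙ h) ∙ (g ∙ h)) ∙ (h ∙ h) ⁻¹    ≈⟨ ∙-congʳ (solve 2 (λ g h → (g ⊕ h) ⊕ (g ⊕ h) ⊜ (g ⊕ g) ⊕ (h ⊕ h))
                                                     refl g h) ⟩
              ((g ∙ g) ∙ (h ∙ h)) ∙ (h ∙ h) ⁻¹    ≈⟨ //-rightDividesʳ (h ∙ h) (g ∙ g) ⟩
              g ∙ g                               ∎)
            (∙-closed (avoid n) (∙-closed (avoid n) gh∈ gh∈) (⁻¹-closed (avoid n) hh∈)))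

        signed-regular : (∀ n → ¬ e n ∙ e n ≈ ε → large p (subset (avoid n))) → large p signed →
          Regular semigroup p
        signed-regular lM lB = signed , lB , λ x FP⊆ l →
          let (g , g≈x₀ , n , g-least , g-sign) = FP⊆ (FP-single semigroup x 0)
              (z , (y , y∈ , z≈) , z∈⋂) = large⇒nonempty p em
                (Ultrafilter.∩-large p l (⋂<-large p N N-large (suc n)))
              (h , h≈y , n′ , h-least , h-sign) = FP⊆ (FP-tail semigroup x y∈)
              gh∈ : ∀ m → m ≤ n → ¬ e m ∙ e m ≈ ε → (g ∙ h) ∈ subset (avoid m)
              gh∈ m m≤n t≉ε = resp (subset (avoid m)) (trans z≈ (sym (∙-cong g≈x₀ h≈y))) (z∈⋂ m (s≤s m≤n) t≉ε)
              h-least′ : Least (λ n → Separates n h) n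
              h-least′ = separates-transfer (gh∈ n ℕ.≤-refl (proj₁ (proj₁ g-least))) (proj₁ g-least) ,
                λ {m} m<n h-sep → proj₂ g-least m<n (separates-transfer
                  (resp (subset (avoid m)) (comm g h) (gh∈ m (ℕ.<⇒≤ m<n) (proj₁ h-sep))) h-sep)
          in not-opposite g-sign (≡.subst (λ k → Sign k h) (least-unique h-least h-least′) h-sign)
               (gh∈ n ℕ.≤-refl (proj₁ (proj₁ g-least)))
          where
          -- Largeness of `avoid n` is assumed only for `e n ∙ e n ≉ ε`, so `N n` imposes nothing
          -- otherwise.
          N : ℕ → Subset setoid
          N n = record
            { pred = λ z → ¬ e n ∙ e n ≈ ε → z ∈ subset (avoid n)
            ; resp = λ z≈w z∈ t≉ε → resp (subset (avoid n)) z≈w (z∈ t≉ε)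
            }
          N-large : ∀ n → large p (N n)
          N-large n with em {e n ∙ e n ≈ ε}
          ... | yes t≈ε = Ultrafilter.upward p (λ _ t≉ε → contradiction t≈ε t≉ε) (whole-large p)
          ... | no  t≉ε = Ultrafilter.upward p (λ z∈ _ → z∈) (lM n t≉ε)

      infix 4 _≡[_]_
      _≡[_]_ : Carrier → ℕ → Carrier → Set ℓ
      g ≡[ n ] h = AbelianGroup._≈_ (quotient G (avoid n)) g h

      -- The coset of g is met before that of g⁻¹ in the enumeration e.
      Positive : ℕ → Carrier → Set ℓ
      Positive n g = ∃[ i ] e i ≡[ n ] g × (∀ {j} → j ≤ i → ¬ e j ≡[ n ] g ⁻¹)

      ∈⇒≡inverse : ∀ {n g h} → (g ∙ h) ∈ subset (avoid n) → g ≡[ n ] h ⁻¹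
      ∈⇒≡inverse {g = g} {h} gh∈ = g ∙ h , gh∈ , sym (//-rightDividesʳ h g)

      -- The cosets would be inverse to each other, and whichever of `i` and `j` comes first meets
      -- the inverse of the other too early.
      positive-not-opposite : ∀ {n g h} → Positive n g → Positive n h → ¬ (g ∙ h) ∈ subset (avoid n)
      positive-not-opposite {n} {g} {h} (i , i≡g , i-first) (j , j≡h , j-first) gh∈ with ℕ.≤-total i j
      ... | inj₁ i≤j = j-first i≤j (Q.trans i≡g (∈⇒≡inverse gh∈))
        where module Q = AbelianGroup (quotient G (avoid n))
      ... | inj₂ j≤i = i-first j≤i (Q.trans j≡h (∈⇒≡inverse (resp (subset (avoid n)) (comm g h) gh∈)))
        where module Q = AbelianGroup (quotient G (avoid n))

      module Plus  = Signed Positive positive-not-opposite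
      negative-not-opposite : ∀ {n g h} → Positive n (g ⁻¹) → Positive n (h ⁻¹) → ¬ (g ∙ h) ∈ subset (avoid n)
      negative-not-opposite {n} {g} {h} g-neg h-neg gh∈ = positive-not-opposite g-neg h-neg
        (resp (subset (avoid n)) (sym (⁻¹-∙-comm g h)) (⁻¹-closed (avoid n) gh∈))

      module Minus = Signed (λ n g → Positive n (g ⁻¹)) negative-not-opposite

      -- Take the first index meeting the coset of `g` or of `g ⁻¹`; these differ because `g ∙ g` is
      -- outside `avoid n`.
      positive-or-negative : ∀ {n g} → g ∈ H → ¬ (g ∙ g) ∈ subset (avoid n) → Positive n g ⊎ Positive n (g ⁻¹)
      positive-or-negative {n} {g} (k , ek≈g) gg∉ = split
        (least (λ i → e i ≡[ n ] g ⊎ e i ≡[ n ] g ⁻¹) (k , inj₁ (≈⇒≡ ek≈g)))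
        where
        module Q = AbelianGroup (quotient G (avoid n))
        ≈⇒≡ : ∀ {g h} → g ≈ h → g ≡[ n ] h
        ≈⇒≡ g≈h = ε , ε∈ (avoid n) , trans g≈h (sym (identityˡ _))
        ≢inverse : ¬ g ≡[ n ] g ⁻¹
        ≢inverse (m , m∈ , eq) =
          gg∉ (resp (subset (avoid n)) (sym (trans (∙-congʳ eq) (//-rightDividesˡ g m))) m∈)
        split : ∃ (Least (λ i → e i ≡[ n ] g ⊎ e i ≡[ n ] g ⁻¹)) → Positive n g ⊎ Positive n (g ⁻¹)
        split (i , inj₁ i≡g , first) = inj₁ (i , i≡g , λ j≤i j≡g⁻¹ →
          [ (λ j<i → first j<i (inj₂ j≡g⁻¹))
          , (λ { ≡.refl → ≢inverse (Q.trans (Q.sym i≡g) j≡g⁻¹) })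
          ]′ (ℕ.m≤n⇒m<n∨m≡n j≤i))
        split (i , inj₂ i≡g⁻¹ , first) = inj₂ (i , i≡g⁻¹ , λ j≤i j≡g⁻¹⁻¹ →
          let j≡g = Q.trans j≡g⁻¹⁻¹ (≈⇒≡ (⁻¹-involutive g)) in
          [ (λ j<i → first j<i (inj₁ j≡g))
          , (λ { ≡.refl → ≢inverse (Q.trans (Q.sym j≡g) i≡g⁻¹) })
          ]′ (ℕ.m≤n⇒m<n∨m≡n j≤i))

      all-large-regular : (∀ n → ¬ e n ∙ e n ≈ ε → large p (subset (avoid n))) →
        ¬ large p (involutions G) → Regular semigroup p
      all-large-regular lM inv-small =
        [ Plus.signed-regular lM , Minus.signed-regular lM ]′
          (large-⊎ p em Plus.signed Minus.signed (Ultrafilter.∩-large p lH (∁-large p inv-small)) cover)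
        where
        cover : ∀ {g} → g ∈ H ∩ ∁ (involutions G) → g ∈ Plus.signed ⊎ g ∈ Minus.signed
        cover {g} (g∈H@(k , ek≈g) , gg≉ε) =
          let kk≈gg = ∙-cong ek≈g ek≈g
              kk≉ε = gg≉ε ∘ trans (sym kk≈gg)
              -- Some index separates: `avoid k` misses `e k ∙ e k`, which is `g ∙ g`.
              (n , g-least) = least (λ n → Separates n g)
                (k , kk≉ε , λ gg∈ → ∉avoiding _ kk≉ε (resp (subset (avoid k)) (sym kk≈gg) gg∈))
          in Sum.map (λ pos → g , refl , n , g-least , pos) (λ neg → g , refl , n , g-least , neg)
               (positive-or-negative g∈H (proj₂ (proj₁ g-least)))

      enumerated-regular : ¬ large p (singleton ε) → Regular semigroup p
      enumerated-regular ε-small with em {large p (involutions G)}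
      ... | yes linv = exponent-two-regular G p sp ε-small linv
      ... | no inv-small with em {∃[ n ] ¬ e n ∙ e n ≈ ε × ¬ large p (subset (avoid n))}
      ... | yes (n , t≉ε , M-small) = quotient-regular n t≉ε M-small
      ... | no none = all-large-regular (λ n t≉ε → ¬¬-elim λ M-small → none (n , t≉ε , M-small)) inv-small

  -- Some `FP x` is large, hence so is the countable submonoid generated by the `x i`; enumerating
  -- all finite index lists, repetitions included, enumerates it.
  abelian-regular : (p : Ultrafilter setoid) → StronglyProductive semigroup p →
    ¬ large p (singleton ε) → Regular semigroup p
  abelian-regular p sp =
    let (x , _ , lFP) = sp (whole p) (whole-large p)
        open Enumerated (sum G x ∘ enumerate)
        ∈H : ∀ as → sum G x as ∈ H
        ∈H as = let (n , eq) = enumerate-surjective as in n , reflexive (≡.cong (sum G x) eq)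
    in enumerated-regular p sp
         (Ultrafilter.upward p (λ (i ∷ as , _ , g≈) →
            resp H (sym (trans g≈ (product≈sum G x i as))) (∈H (i ∷ as))) lFP)
         (λ (m , em≈g) (n , en≈h) →
            resp H (trans (sum-++ G x (enumerate m) (enumerate n)) (∙-cong em≈g en≈h))
                   (∈H (enumerate m ++ enumerate n)))
         (∈H [])

-- Commutative archimedean semigroups

module _ {ℓ : Level} (S : Semigroup ℓ ℓ) (∙-comm : IsCommutative S) where
  open Semigroup S
  open ≈-Reasoning setoid

  commutativeSemigroup : CommutativeSemigroup ℓ ℓ
  commutativeSemigroup = record { isCommutativeSemigroup = record { isSemigroup = isSemigroup ; comm = ∙-comm } }

  open CommutativeSemigroupProperties commutativeSemigroup

  -- power x n is the (n+1)-st power of x.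
  power : Carrier → ℕ → Carrier
  power x zero    = x
  power x (suc n) = x ∙ power x n

  Archimedean : Set ℓ
  Archimedean = ∀ x y → ∃[ n ] ∃[ w ] power x n ≈ y ∙ w

  -- Archimedean semigroups with zero

  -- Every element that becomes trivial in the group of fractions is of this kind.
  localUnits : Subset setoid
  localUnits = record
    { pred = λ x → ∃[ z ] x ∙ z ≈ z
    ; resp = λ x≈y (z , eq) → z , trans (∙-congʳ (sym x≈y)) eq
    }

  power-fixes : ∀ {x f} → x ∙ f ≈ f → ∀ n → power x n ∙ f ≈ f
  power-fixes xf≈f zero    = xf≈f
  power-fixes xf≈f (suc n) = trans (assoc _ _ _) (trans (∙-congˡ (power-fixes xf≈f n)) xf≈f)

  power-idempotent : ∀ {f} → f ∙ f ≈ f → ∀ n → power f n ≈ f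
  power-idempotent ff≈f zero    = refl
  power-idempotent ff≈f (suc n) = trans (∙-congˡ (power-idempotent ff≈f n)) ff≈f

  module Nil (arch : Archimedean) where

    idempotent-≤ : ∀ {e f} → e ∙ e ≈ e → f ∙ f ≈ f → e ∙ f ≈ f
    idempotent-≤ {e} {f} ee≈e ff≈f with arch f e
    ... | n , w , eq = begin
      e ∙ f        ≈⟨ ∙-congˡ f≈ew ⟩
      e ∙ (e ∙ w)  ≈⟨ assoc e e w ⟨
      (e ∙ e) ∙ w  ≈⟨ ∙-congʳ ee≈e ⟩
      e ∙ w        ≈⟨ f≈ew ⟨
      f            ∎
      where
      f≈ew : f ≈ e ∙ w
      f≈ew = trans (sym (power-idempotent ff≈f n)) eq

    idempotent-unique : ∀ {e f} → e ∙ e ≈ e → f ∙ f ≈ f → e ≈ f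
    idempotent-unique ee ff = trans (sym (idempotent-≤ ff ee)) (trans (∙-comm _ _) (idempotent-≤ ee ff))

    -- Some power of `x` is a multiple of the element `z` fixed by `x`.
    eventually-fixed : ∀ {x} → x ∈ localUnits → ∃[ n ] x ∙ power x n ≈ power x n
    eventually-fixed {x} (z , xz≈z) with arch x z
    ... | n , w , eq = n , (begin
      x ∙ power x n  ≈⟨ ∙-congˡ eq ⟩
      x ∙ (z ∙ w)    ≈⟨ assoc x z w ⟨
      (x ∙ z) ∙ w    ≈⟨ ∙-congʳ xz≈z ⟩
      z ∙ w          ≈⟨ eq ⟨
      power x n      ∎)

    -- The power fixed by `x` is idempotent, and there is only one idempotent. So `e` is a zero for
    -- the local units.
    nil : ∀ {e x} → e ∙ e ≈ e → x ∈ localUnits → ∃[ n ] power x n ≈ e × x ∙ e ≈ e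
    nil {e} {x} ee≈e x∈ =
      let (n , fixed) = eventually-fixed x∈
          eq = idempotent-unique (power-fixes fixed n) ee≈e
      in n , eq , trans (∙-congˡ (sym eq)) (trans fixed eq)

    power-product : ∀ {g y} → (∀ i → ∃[ s ] y i ≈ g ∙ s) → ∀ n i →
      ∃[ as ] Linked _<_ (i ∷ as) × ∃[ s ] product S y (i ∷ as) ≈ power g n ∙ s
    power-product divides zero    i = [] , [-] , divides i
    power-product {g} divides (suc n) i =
      let (as , incr , s , eq) = power-product divides n (suc i)
          (t , eq′) = divides i
      in suc i ∷ as , ℕ.n<1+n i ∷ incr , t ∙ s , trans (∙-cong eq′ eq) (interchange g t (power g n) s)

    -- If the translate by `x 0` were large, some `FP y` in `B` would consist of multiples of `x 0`.
    -- A long enough product of the `y i` is then a multiple of a power of `x 0` equal to `e`, so it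
    -- equals the excluded zero.
    nil-regular : ExcludedMiddle ℓ → (p : Ultrafilter setoid) → StronglyProductive S p → Free p →
      large p localUnits → Regular S p
    nil-regular em p sp free lU = B , lB , bad
      where
      e∃ : ∃[ e ] e ∙ e ≈ e
      e∃ = let (x , x∈) = large⇒nonempty p em lU
               (n , fixed) = eventually-fixed x∈
           in power x n , power-fixes fixed n
      e = proj₁ e∃
      ee≈e = proj₂ e∃
      B = localUnits ∩ ∁ (singleton e)
      lB = Ultrafilter.∩-large p lU (∁-large p (free e))
      bad : ∀ x → FP S x ⊆ B → ¬ large p (translate S (x 0) (FP[_] S 1 x))
      bad x FP⊆ l =
        let (y , FPy⊆ , _) = sp _ (Ultrafilter.∩-large p l lB)
            (n , power≈e , _) = nil ee≈e (proj₁ (FP⊆ (FP-single S x 0)))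
            (as , incr , s , eq) = power-product
              (λ i → let ((s , _ , eq) , _) = FPy⊆ (FP-single S y i) in s , eq) n 0
            v = product S y (0 ∷ as)
            (_ , v∈U , v≉e) = FPy⊆ (0 ∷ as , incr , refl)
            (_ , _ , ve≈e) = nil ee≈e v∈U
            v≈es = trans eq (∙-congʳ power≈e)
        in v≉e (begin
             v              ≈⟨ v≈es ⟩
             e ∙ s          ≈⟨ ∙-congʳ ee≈e ⟨
             (e ∙ e) ∙ s    ≈⟨ xy∙z≈xz∙y e e s ⟩
             (e ∙ s) ∙ e    ≈⟨ ∙-congʳ v≈es ⟨
             v ∙ e          ≈⟨ ve≈e ⟩
             e              ∎)

  -- The group of fractions

  module _ (c : Carrier) where

    private
      Fraction : Set ℓ
      Fraction = Carrier × Carrier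

      -- The extra factor `z` makes the relation transitive where cancellation fails.
      _~_ : Fraction → Fraction → Set ℓ
      (a , b) ~ (a′ , b′) = ∃[ z ] z ∙ (a ∙ b′) ≈ z ∙ (a′ ∙ b)

      regroup : ∀ z w d a f → ((z ∙ w) ∙ d) ∙ (a ∙ f) ≈ (z ∙ (a ∙ d)) ∙ (w ∙ f)
      regroup z w d a f = begin
        ((z ∙ w) ∙ d) ∙ (a ∙ f)  ≈⟨ assoc (z ∙ w) d (a ∙ f) ⟩
        (z ∙ w) ∙ (d ∙ (a ∙ f))  ≈⟨ ∙-congˡ (x∙yz≈yx∙z d a f) ⟩
        (z ∙ w) ∙ ((a ∙ d) ∙ f)  ≈⟨ interchange z w (a ∙ d) f ⟩
        (z ∙ (a ∙ d)) ∙ (w ∙ f)  ∎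

      ~-trans : ∀ {x y z} → x ~ y → y ~ z → x ~ z
      ~-trans {a , b} {c , d} {e , f} (z , eq) (w , eq′) = (z ∙ w) ∙ d , (begin
        ((z ∙ w) ∙ d) ∙ (a ∙ f)  ≈⟨ regroup z w d a f ⟩
        (z ∙ (a ∙ d)) ∙ (w ∙ f)  ≈⟨ ∙-congʳ eq ⟩
        (z ∙ (c ∙ b)) ∙ (w ∙ f)  ≈⟨ interchange z (c ∙ b) w f ⟩
        (z ∙ w) ∙ ((c ∙ b) ∙ f)  ≈⟨ ∙-cong (∙-comm z w) (xy∙z≈xz∙y c b f) ⟩
        (w ∙ z) ∙ ((c ∙ f) ∙ b)  ≈⟨ interchange w z (c ∙ f) b ⟩
        (w ∙ (c ∙ f)) ∙ (z ∙ b)  ≈⟨ ∙-congʳ eq′ ⟩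
        (w ∙ (e ∙ d)) ∙ (z ∙ b)  ≈⟨ regroup w z d e b ⟨
        ((w ∙ z) ∙ d) ∙ (e ∙ b)  ≈⟨ ∙-congʳ (∙-congʳ (∙-comm w z)) ⟩
        ((z ∙ w) ∙ d) ∙ (e ∙ b)  ∎)

      ≈⇒~ : ∀ {a b a′ b′} → a ≈ a′ → b ≈ b′ → (a , b) ~ (a′ , b′)
      ≈⇒~ a≈a′ b≈b′ = c , ∙-congˡ (∙-cong a≈a′ (sym b≈b′))

      ~-cong : ∀ {x y u v} → x ~ y → u ~ v →
        (proj₁ x ∙ proj₁ u , proj₂ x ∙ proj₂ u) ~ (proj₁ y ∙ proj₁ v , proj₂ y ∙ proj₂ v)
      ~-cong {a , b} {a′ , b′} {d , e} {d′ , e′} (z , eq) (w , eq′) = z ∙ w , (begin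
        (z ∙ w) ∙ ((a ∙ d) ∙ (b′ ∙ e′))    ≈⟨ ∙-congˡ (interchange a d b′ e′) ⟩
        (z ∙ w) ∙ ((a ∙ b′) ∙ (d ∙ e′))    ≈⟨ interchange z w _ _ ⟩
        (z ∙ (a ∙ b′)) ∙ (w ∙ (d ∙ e′))    ≈⟨ ∙-cong eq eq′ ⟩
        (z ∙ (a′ ∙ b)) ∙ (w ∙ (d′ ∙ e))    ≈⟨ interchange z _ w _ ⟩
        (z ∙ w) ∙ ((a′ ∙ b) ∙ (d′ ∙ e))    ≈⟨ ∙-congˡ (interchange a′ b d′ e) ⟩
        (z ∙ w) ∙ ((a′ ∙ d′) ∙ (b ∙ e))    ∎)

      ~-identityˡ : ∀ x → (c ∙ proj₁ x , c ∙ proj₂ x) ~ x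
      ~-identityˡ (a , b) = c , ∙-congˡ (xy∙z≈y∙xz c a b)

      ~-inverseˡ : ∀ x → (proj₂ x ∙ proj₁ x , proj₁ x ∙ proj₂ x) ~ (c , c)
      ~-inverseˡ (a , b) = c , ∙-congˡ (trans (∙-comm (b ∙ a) c) (∙-congˡ (∙-comm b a)))

      ~-comm : ∀ x y → (proj₁ x ∙ proj₁ y , proj₂ x ∙ proj₂ y) ~ (proj₁ y ∙ proj₁ x , proj₂ y ∙ proj₂ x)
      ~-comm (a , b) (a′ , b′) = ≈⇒~ (∙-comm a a′) (∙-comm b b′)

    fractions : AbelianGroup ℓ ℓ
    fractions = record
      { Carrier = Fraction
      ; _≈_     = _~_
      ; _∙_     = λ (a , b) (a′ , b′) → a ∙ a′ , b ∙ b′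
      ; ε       = c , c
      ; _⁻¹     = λ (a , b) → b , a
      ; isAbelianGroup = record
        { isGroup = record
          { isMonoid = record
            { isSemigroup = record
              { isMagma = record
                { isEquivalence = record
                  { refl  = ≈⇒~ refl refl
                  ; sym   = λ (z , eq) → z , sym eq
                  ; trans = ~-trans
                  }
                ; ∙-cong = ~-cong
                }
              ; assoc = λ x y z → ≈⇒~ (assoc _ _ _) (assoc _ _ _)
              }
            ; identity = ~-identityˡ , λ x → ~-trans (~-comm x (c , c)) (~-identityˡ x)
            }
          ; inverse  = ~-inverseˡ , λ (a , b) → ~-inverseˡ (b , a)
          ; ⁻¹-cong  = λ {(a , b)} {(a′ , b′)} (z , eq) → z ,
              trans (∙-congˡ (∙-comm b a′)) (trans (sym eq) (∙-congˡ (∙-comm a b′)))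
          }
        ; comm = ~-comm
        }
      }

    -- S need not have a unit, so x is represented by xx / x.
    fraction : Carrier → AbelianGroup.Carrier fractions
    fraction x = x ∙ x , x

    fraction-hom : IsMagmaHomomorphism rawMagma (AbelianGroup.rawMagma fractions) fraction
    fraction-hom = record
      { isRelHomomorphism = record { cong = λ x≈y → ≈⇒~ (∙-cong x≈y x≈y) x≈y }
      ; homo              = λ x y → ≈⇒~ (interchange x y x y) refl
      }

    fraction≈ε⇒localUnit : ∀ {x} → AbelianGroup._≈_ fractions (fraction x) (c , c) → x ∈ localUnits
    fraction≈ε⇒localUnit {x} (z , eq) = z ∙ (c ∙ x) , (begin
      x ∙ (z ∙ (c ∙ x))  ≈⟨ x∙yz≈y∙xz x z (c ∙ x) ⟩
      z ∙ (x ∙ (c ∙ x))  ≈⟨ ∙-congˡ (x∙yz≈xz∙y x c x) ⟩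
      z ∙ ((x ∙ x) ∙ c)  ≈⟨ eq ⟩
      z ∙ (c ∙ x)        ∎)

  archimedean-regular : ExcludedMiddle ℓ → Archimedean → (p : Ultrafilter setoid) →
    StronglyProductive S p → Free p → Regular S p
  archimedean-regular em arch p sp free
    with large⇒nonempty p em (whole-large p)
  ... | c , _ with em {large p (preimage S (AbelianGroup.semigroup (fractions c)) (fraction-hom c)
                                  (singleton (c , c)))}
  ... | yes l = Nil.nil-regular arch em p sp free (Ultrafilter.upward p (fraction≈ε⇒localUnit c) l)
  ... | no ¬l = pushforward-regular S K (fraction-hom c) p
                  (abelian-regular em (fractions c) (pushforward S K (fraction-hom c) p)
                    (pushforward-sp S K (fraction-hom c) p sp) ¬l)
    where K = AbelianGroup.semigroup (fractions c)

module _ {ℓ : Level} (S : Semigroup ℓ ℓ) (∙-comm : IsCommutative S) where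
  open Semigroup S
  open ≈-Reasoning setoid
  open CommutativeSemigroupProperties (commutativeSemigroup S ∙-comm)
  private
    infixl 8 _^⁺_
    _^⁺_ = power S ∙-comm

  -- Archimedean components

  power-cong : ∀ {x y} n → x ≈ y → x ^⁺ n ≈ y ^⁺ n
  power-cong zero    x≈y = x≈y
  power-cong (suc n) x≈y = ∙-cong x≈y (power-cong n x≈y)

  power-+ : ∀ x m n → x ^⁺ m ∙ x ^⁺ n ≈ x ^⁺ suc (m + n)
  power-+ x zero    n = refl
  power-+ x (suc m) n = trans (assoc x _ _) (∙-congˡ (power-+ x m n))

  power-∙ : ∀ x y n → (x ∙ y) ^⁺ n ≈ x ^⁺ n ∙ y ^⁺ n
  power-∙ x y zero    = refl
  power-∙ x y (suc n) = trans (∙-congˡ (power-∙ x y n)) (interchange x y _ _)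

  power-power : ∀ x m n → ∃[ k ] (x ^⁺ m) ^⁺ n ≈ x ^⁺ k
  power-power x m zero    = m , refl
  power-power x m (suc n) = let (k , eq) = power-power x m n in
    suc (m + k) , trans (∙-congˡ eq) (power-+ x m k)

  _DividesPowerOf_ : Carrier → Carrier → Set ℓ
  x DividesPowerOf y = ∃[ n ] ∃[ w ] y ^⁺ n ≈ x ∙ w

  divides-reflexive : ∀ {x y} → x ≈ y → x DividesPowerOf y
  divides-reflexive {x} {y} x≈y = 1 , y , ∙-congʳ (sym x≈y)

  divides-trans : ∀ {x y z} → x DividesPowerOf y → y DividesPowerOf z → x DividesPowerOf z
  divides-trans {x} {y} {z} (n , w , eq) (m , v , eq′) =
    let (k , eq″) = power-power z m n in k , w ∙ v ^⁺ n , (begin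
      z ^⁺ k               ≈⟨ eq″ ⟨
      (z ^⁺ m) ^⁺ n        ≈⟨ power-cong n eq′ ⟩
      (y ∙ v) ^⁺ n         ≈⟨ power-∙ y v n ⟩
      y ^⁺ n ∙ v ^⁺ n      ≈⟨ ∙-congʳ eq ⟩
      (x ∙ w) ∙ v ^⁺ n     ≈⟨ assoc x w _ ⟩
      x ∙ (w ∙ v ^⁺ n)     ∎)

  divides-cong : ∀ {x y u v} → x DividesPowerOf y → u DividesPowerOf v → (x ∙ u) DividesPowerOf (y ∙ v)
  divides-cong {x} {y} {u} {v} (n , w , eq) (m , t , eq′) =
    -- Indices are exponents minus one, so `suc (n + m)` stands for the exponent (n + 1) + (m + 1).
    suc (n + m) , (w ∙ t) ∙ (y ^⁺ m ∙ v ^⁺ n) , (begin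
      (y ∙ v) ^⁺ suc (n + m)                        ≈⟨ power-∙ y v (suc (n + m)) ⟩
      y ^⁺ suc (n + m) ∙ v ^⁺ suc (n + m)           ≈⟨ ∙-cong (power-+ y n m)
                                                         (trans (∙-comm _ _) (power-+ v n m)) ⟨
      (y ^⁺ n ∙ y ^⁺ m) ∙ (v ^⁺ m ∙ v ^⁺ n)         ≈⟨ interchange _ _ _ _ ⟩
      (y ^⁺ n ∙ v ^⁺ m) ∙ (y ^⁺ m ∙ v ^⁺ n)         ≈⟨ ∙-congʳ (∙-cong eq eq′) ⟩
      ((x ∙ w) ∙ (u ∙ t)) ∙ (y ^⁺ m ∙ v ^⁺ n)       ≈⟨ ∙-congʳ (interchange x w u t) ⟩
      ((x ∙ u) ∙ (w ∙ t)) ∙ (y ^⁺ m ∙ v ^⁺ n)       ≈⟨ assoc _ _ _ ⟩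
      (x ∙ u) ∙ ((w ∙ t) ∙ (y ^⁺ m ∙ v ^⁺ n))       ∎)

  mutualDivisibility : Congruence S
  mutualDivisibility = record
    { _∼_           = λ x y → x DividesPowerOf y × y DividesPowerOf x
    ; isEquivalence = record
      { refl  = divides-reflexive refl , divides-reflexive refl
      ; sym   = λ (x∣y , y∣x) → y∣x , x∣y
      ; trans = λ (x∣y , y∣x) (y∣z , z∣y) → divides-trans x∣y y∣z , divides-trans z∣y y∣x
      }
    ; ≈⇒∼           = λ x≈y → divides-reflexive x≈y , divides-reflexive (sym x≈y)
    ; ∙-cong        = λ (x∣y , y∣x) (u∣v , v∣u) → divides-cong x∣y u∣v , divides-cong y∣x v∣u
    }

  -- Mutual divisibility up to powers is a semilattice congruence, so it contains the least one.
  η⇒divides : ∀ {x y} → _η_ S x y → y DividesPowerOf x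
  η⇒divides xηy = proj₂ (η-least S mutualDivisibility
    -- Index 2 is the cube of `x`, a multiple of `x ∙ x`; index 0 is `x ∙ x` itself, a multiple of
    -- `x`.
    ( (λ x → (2 , x , sym (assoc x x x)) , (0 , x , refl))
    , (λ x y → Congruence.≈⇒∼ mutualDivisibility (∙-comm x y))) xηy)

  module Component (m : Carrier) where
    private
      infix 4 _η′_
      _η′_ = _η_ S

    component : Subset setoid
    component = record { pred = _η′ m ; resp = λ x≈y xηm → η-tran (base (sym x≈y)) xηm }

    component-closed : ∀ {x y} → x ∈ component → y ∈ component → (x ∙ y) ∈ component
    component-closed xηm yηm = η-tran (η-cong xηm yηm) (η-idem m)

    power-η : ∀ x n → x ^⁺ n η′ x
    power-η x zero    = base refl
    power-η x (suc n) = η-tran (η-cong (base refl) (power-η x n)) (η-idem x)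

    T : Semigroup ℓ ℓ
    T = subsemigroup S (pred component) component-closed

    T-comm : IsCommutative T
    T-comm (x , _) (y , _) = ∙-comm x y

    power-proj₁ : ∀ x n → proj₁ (power T T-comm x n) ≡ proj₁ x ^⁺ n
    power-proj₁ x zero    = ≡.refl
    power-proj₁ x (suc n) = ≡.cong (proj₁ x ∙_) (power-proj₁ x n)

    -- The cofactor `w` may lie outside the component, but `w ∙ x` is related to `w ∙ y`, a power of
    -- `x`. Hence one more factor `x` is spent.
    component-archimedean : Archimedean T T-comm
    component-archimedean (x , xηm) (y , yηm) =
      let (n , w , eq) = η⇒divides (η-tran xηm (η-sym yηm))
          wηm : w ∙ x η′ m
          wηm = η-tran (η-cong (base refl) (η-tran xηm (η-sym yηm)))
                (η-tran (base (trans (∙-comm w y) (sym eq)))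
                (η-tran (power-η x n) xηm))
      in suc n , (w ∙ x , wηm) ,
         trans (∙-congˡ (trans (reflexive (power-proj₁ (x , xηm) n)) eq))
               (trans (∙-comm x _) (assoc y w x))

  -- Minimal large lower sets

  module _ (em : ExcludedMiddle ℓ) (wf : WellFoundedSemilattice (universalSemilattice S))
           (p : Ultrafilter setoid) (sp : StronglyProductive S p) (free : Free p) where
    open Ultrafilter p using (upward; ∩-large)
    private
      infix 4 _η′_
      _η′_ = _η_ S

    below : Carrier → Subset setoid
    below m = record
      { pred = λ x → x η′ x ∙ m
      ; resp = λ x≈y x≤m → η-tran (base (sym x≈y)) (η-tran x≤m (base (∙-congʳ x≈y)))
      }

    translate-below : ∀ s A → translate S s A ⊆ below s
    translate-below s A {z} (y , _ , z≈sy) =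
      η-tran (base z≈sy) (η-tran (η-cong (η-sym (η-idem s)) (base refl))
        (base (trans (xy∙z≈xz∙y s s y) (∙-congʳ (sym z≈sy)))))

    large-below : Subset (Semilattice.setoid (universalSemilattice S))
    large-below = record
      { pred = λ m → large p (below m)
      ; resp = λ mηm′ → upward (λ x≤m → η-tran x≤m (η-cong (base refl) mηm′))
      }

    commutative-regular : Regular S p
    commutative-regular with em {Nonempty large-below}
    -- The translate lies below `x 0`, so it cannot be large.
    ... | no  none     = whole p , whole-large p , λ x _ l →
            none (x 0 , upward (translate-below (x 0) (FP[_] S 1 x)) l)
    ... | yes nonempty with wf large-below nonempty
    ... | m , m-large , m-minimal with em {large p (Component.component m)}
    ... | yes l = restrict-regular S component component-closed p l
                    (archimedean-regular T T-comm em component-archimedean (restrict S component component-closed p l)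
                      (restrict-sp S component component-closed p l sp)
                      (restrict-free S component component-closed p l free))
      where open Component m
    -- If the translate were large, `x 0` would be a member of `large-below` strictly under the
    -- minimal `m`.
    ... | no ¬l = below m ∩ ∁ component , ∩-large m-large (∁-large p ¬l) , λ x FP⊆ l →
                    let (x₀≤m , x₀∉) = FP⊆ (FP-single S x 0) in
                    x₀∉ (m-minimal (x 0) (upward (translate-below (x 0) (FP[_] S 1 x)) l) x₀≤m)
      where open Component m

-- Well-founded semilattices

module _ {ℓ : Level} (L M : Semilattice ℓ ℓ) where
  private
    module L = Semilattice L
    module M = Semilattice M

  -- For `m` minimal in the preimage and `y ≤ f m` with `y ≈ f e`, the element `e ∙ m` is in the
  -- preimage and below `m`, hence equal to `m`.
  wellFounded-image : {f : L.Carrier → M.Carrier} →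
    IsMagmaHomomorphism (Semigroup.rawMagma L.semigroup) (Semigroup.rawMagma M.semigroup) f →
    (∀ y → ∃[ x ] y M.≈ f x) → WellFoundedSemilattice L → WellFoundedSemilattice M
  wellFounded-image {f} hom surjective wf A (a , a∈A) =
    let (b , a≈fb) = surjective a
        (m , fm∈A , minimal) = wf (preimage L.semigroup M.semigroup hom A) (b , resp A a≈fb a∈A)
    in f m , fm∈A , λ y y∈A y≤fm →
      let (e , y≈fe) = surjective y
          y≈fem = M.trans y≤fm (M.trans (M.∙-congʳ y≈fe) (M.sym (homo e m)))
          em≈m = minimal (e L.∙ m) (resp A y≈fem y∈A)
                   (L.sym (L.trans (L.assoc e m m) (L.∙-congˡ (L.idem m))))
      in M.trans y≈fem (⟦⟧-cong em≈m)
    where open IsMagmaHomomorphism hom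

-- Solvable inverse semigroups

module _ {ℓ : Level} (S : Semigroup ℓ ℓ) (inv : IsInverseSemigroup S) (γ : Congruence S) where
  open Semigroup S
  open Congruence γ using (_∼_; ≈⇒∼) renaming (∙-cong to ∼-cong)

  quotient-hom : IsMagmaHomomorphism rawMagma (Semigroup.rawMagma (S / γ)) id
  quotient-hom = record
    { isRelHomomorphism = record { cong = ≈⇒∼ }
    ; homo              = λ _ _ → ≈⇒∼ refl
    }

  -- With `y` the inverse of `x`, x = xyx is η-related to xxy and so to the idempotent xy. Thus the
  -- idempotents map onto the universal semilattice.
  universal-wellFounded : WellFoundedSemilattice (idempotentSemilattice S inv) →
    WellFoundedSemilattice (universalSemilattice (S / γ))
  universal-wellFounded = wellFounded-image (idempotentSemilattice S inv) (universalSemilattice (S / γ))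
    (record { isRelHomomorphism = record { cong = base ∘ ≈⇒∼ } ; homo = λ _ _ → base (≈⇒∼ refl) })
    λ x → let (y , (xyx≈x , _) , _) = inv x in
      (x ∙ y , trans (sym (assoc (x ∙ y) x y)) (∙-congʳ xyx≈x)) ,
      η-tran (base (≈⇒∼ (sym xyx≈x)))
      (η-tran (η-comm (x ∙ y) x)
      (η-tran (base (≈⇒∼ (sym (assoc x x y))))
              (η-cong (η-idem x) (base (≈⇒∼ refl)))))

  module _ (∙-comm : IsCommutative (S / γ)) where
    private
      module ∼ = IsEquivalence (Congruence.isEquivalence γ)
      T = idempotentPreimage S γ ∙-comm

    idempotentClasses : Subset setoid
    idempotentClasses = record
      { pred = IsIdempotent (S / γ)
      ; resp = λ x≈y xx∼x → ∼.trans (∼.sym (∼-cong (≈⇒∼ x≈y) (≈⇒∼ x≈y))) (∼.trans xx∼x (≈⇒∼ x≈y))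
      }

    -- `S` and `T` have the same idempotents, since idempotents have idempotent classes.
    idempotentPreimage-wellFounded : (T-inv : IsInverseSemigroup T) →
      WellFoundedSemilattice (idempotentSemilattice S inv) → WellFoundedSemilattice (idempotentSemilattice T T-inv)
    idempotentPreimage-wellFounded T-inv = wellFounded-image (idempotentSemilattice S inv) (idempotentSemilattice T T-inv)
      {f = λ (e , ee≈e) → (e , ≈⇒∼ ee≈e) , ee≈e}
      (record { isRelHomomorphism = record { cong = id } ; homo = λ _ _ → refl })
      (λ ((e , _) , ee≈e) → (e , ee≈e) , refl)

    module _ (em : ExcludedMiddle ℓ) (wf : WellFoundedSemilattice (idempotentSemilattice S inv))
             (p : Ultrafilter setoid) (sp : StronglyProductive S p) (free : Free p) where
      private
        q : Ultrafilter (Semigroup.setoid (S / γ))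
        q = pushforward S (S / γ) quotient-hom p

        q-sp : StronglyProductive (S / γ) q
        q-sp = pushforward-sp S (S / γ) quotient-hom p sp

      free-image-regular : Free q → Regular S p
      free-image-regular q-free = pushforward-regular S (S / γ) quotient-hom p
        (commutative-regular (S / γ) ∙-comm em (universal-wellFounded wf) q q-sp q-free)

      -- The class at which the image is principal is idempotent, so the preimage of the idempotents
      -- is large and `p` restricts to it.
      principal-image-regular :
        ((p : Ultrafilter (Semigroup.setoid T)) → StronglyProductive T p → Free p → Regular T p) →
        ∀ x → large q (singleton x) → Regular S p
      principal-image-regular T-regular x l = restrict-regular S idempotentClasses closed p P-large
        (T-regular (restrict S idempotentClasses closed p P-large)
          (restrict-sp S idempotentClasses closed p P-large sp)
          (restrict-free S idempotentClasses closed p P-large free))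
        where
        closed : ∀ {x y} → x ∈ idempotentClasses → y ∈ idempotentClasses → (x ∙ y) ∈ idempotentClasses
        closed {x} {y} = commutingIdempotents-closed (S / γ) (∙-comm x y)
        xx∼x : (x ∙ x) ∼ x
        xx∼x = sp-principal⇒idempotent (S / γ) q q-sp l
        P-large : large p idempotentClasses
        P-large = Ultrafilter.upward p (λ y∼x → ∼.trans (∼-cong y∼x y∼x) (∼.trans xx∼x (∼.sym y∼x))) l

-- The quotient by equality is `S` itself, so `universal-wellFounded` also serves class 1.
equality : ∀ {ℓ} (S : Semigroup ℓ ℓ) → Congruence S
equality S = record { _∼_ = _≈_ ; isEquivalence = isEquivalence ; ≈⇒∼ = id ; ∙-cong = ∙-cong }
  where open Semigroup S

solvable-regular : ∀ {ℓ n} {S : Semigroup ℓ ℓ} → ExcludedMiddle ℓ → (solvable : IsSolvableInverse n S) →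
  WellFoundedSemilattice (idempotentSemilattice S (solvable⇒inverse solvable)) →
  (p : Ultrafilter (Semigroup.setoid S)) → StronglyProductive S p → Free p → Regular S p
solvable-regular {S = S} em (class-one inv ∙-comm) wf p sp free =
  commutative-regular S ∙-comm em (universal-wellFounded S inv (equality S) wf) p sp free
solvable-regular {S = S} em (class-suc inv γ ∙-comm solvable) wf p sp free =
  [ (λ (x , l) → principal-image-regular S inv γ ∙-comm em wf p sp free
       (solvable-regular em solvable (idempotentPreimage-wellFounded S inv γ ∙-comm (solvable⇒inverse solvable) wf)) x l)
  , free-image-regular S inv γ ∙-comm em wf p sp free
  ]′ (principal-or-free (pushforward S (S / γ) (quotient-hom S inv γ) p) em)

mainTheorem2 : ∀ {ℓ : Level} (S : Semigroup ℓ ℓ) →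
    (IsCommutative S × WellFoundedSemilattice (universalSemilattice S))
    ⊎ (Σ[ n ∈ ℕ ] Σ[ solvable ∈ IsSolvableInverse n S ]
    WellFoundedSemilattice (idempotentSemilattice S (solvable⇒inverse solvable))) →
    (p : Ultrafilter (Semigroup.setoid S)) →
    Nonprincipal p → StronglyProductive S p → Regular S p
mainTheorem2 S (inj₁ (∙-comm , wf)) p nonprincipal sp =
  commutative-regular S ∙-comm em wf p sp (nonprincipal⇒free p em nonprincipal)
  where em = sp⇒em S p sp
mainTheorem2 S (inj₂ (_ , solvable , wf)) p nonprincipal sp =
  solvable-regular em solvable wf p sp (nonprincipal⇒free p em nonprincipal)
  where em = sp⇒em S p sp
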